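{- Let $k\geq 3$, let $n$ be a positive odd integer, and let $G_1=P_1\times\cdots\times P_m$ ($m\geq 1$) be a finite nilpotent group of odd order whose Sylow subgroups $P_1,\dots,P_m$ (for the distinct prime divisors $p_1,\dots,p_m$ of $|G_1|$) are not cyclic. Let $r_i$ be the number of distinct subgroups of order $p_i$ in $P_i$, indexed so that $r_1\leq r_2\leq\cdots\leq r_m$. (a) If $G=Q_{2^k}$ or $G=\mathbb{Z}_n\times Q_{2^k}$, then $\gamma^{\text{strong}}(\mathcal{G}_E^{**}(G))=2^{k-1}+2$. (b) If $G=G_1\times Q_{2^k}$, or $G=G_1\times\mathbb{Z}_n\times Q_{2^k}$ with $\gcd(|G_1|,n)=1$, then $\gamma^{\text{strong}}(\mathcal{G}_E^{**}(G))=\min\{r_1,\,2^{k-2}+1\}+1$.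
   Context: $\mathbb{Z}_n$ denotes the cyclic group of order $n$. The generalized quaternion group $Q_{2^k}$ ($k\geq 3$) is the group of order $2^k$ generated by $x,y$ with $x^{2^{k-1}}=1$, $x^{2^{k-2}}=y^2$ and $yxy^{ -1}=x^{ -1}$. The enhanced power graph $\mathcal{G}_E(G)$ of a group $G$ is the simple graph with vertex set $G$ in which two distinct vertices $u,v$ are adjacent if and only if there is $w\in G$ with $u\in\langle w\rangle$ and $v\in\langle w\rangle$. A dominating vertex of a graph is a vertex adjacent to every other vertex. The proper enhanced power graph $\mathcal{G}_E^{**}(G)$ is the graph obtained from $\mathcal{G}_E(G)$ by deleting all of its dominating vertices (including the identity). A total dominating set (or strongly dominating set) of a graph $\Gamma=(V,E)$ is a set $D\subseteq V$ such that every vertex $u\in V$ (including those in $D$) is adjacent to some $v\in D$. The strong domination number $\gamma^{\text{strong}}(\Gamma)$ is the minimum cardinality of a total dominating set of $\Gamma$. -}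

module Defs where

open import Algebra.Bundles using (Group)
import Algebra.Definitions.RawMonoid as RawMonoidOperations
open import Data.Fin using (Fin)
open import Data.Nat using (ℕ; zero; suc; _+_; _∸_; _^_; _≤_)
open import Data.Nat.Divisibility using (_∣_)
open import Data.Nat.Primality using (Prime)
open import Data.Product using (_×_; ∃-syntax; _,_; proj₁; proj₂)
open import Data.Sum using (_⊎_)
open import Function using (_∘_)
open import Function.Bundles using (Inverse; _⇔_)
open import Function.Definitions using (Injective)
open import Level using (Level; _⊔_) renaming (suc to lsuc)
open import Relation.Binary using (Rel; Setoid; Symmetric; _Respects_; _Respects₂_)
import Relation.Binary.Construct.On as On
open import Relation.Binary.PropositionalEquality using (_≡_)
import Relation.Binary.PropositionalEquality.Properties as ≡
open import Relation.Nullary using (¬_)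
open import Relation.Unary using (Pred; _∈_)
open import Relation.Unary.Relation.Binary.Equality using (≐-setoid)

private
  variable
    a c ℓ p v e : Level

HasCardinality : Setoid a ℓ → ℕ → Set (a ⊔ ℓ)
HasCardinality S n = Inverse S (≡.setoid (Fin n))

subsetoid : (S : Setoid a ℓ) → Pred (Setoid.Carrier S) p → Setoid (a ⊔ p) ℓ
subsetoid S P = On.setoid S (proj₁ {B = P})

HasOrder : Group c ℓ → ℕ → Set (c ⊔ ℓ)
HasOrder G = HasCardinality (Group.setoid G)

module _ (G : Group c ℓ) where
  open Group G

  data Generated (S : Pred Carrier ℓ) : Pred Carrier (c ⊔ ℓ) where
    gen  : ∀ {g} → g ∈ S → g ∈ Generated S
    resp : ∀ {g h} → g ≈ h → g ∈ Generated S → h ∈ Generated S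
    one  : ε ∈ Generated S
    mul  : ∀ {g h} → g ∈ Generated S → h ∈ Generated S → g ∙ h ∈ Generated S
    inv  : ∀ {g} → g ∈ Generated S → g ⁻¹ ∈ Generated S

  ⟨_⟩ : Carrier → Pred Carrier (c ⊔ ℓ)
  ⟨ w ⟩ = Generated (_≈ w)

  IsCyclic : Set (c ⊔ ℓ)
  IsCyclic = ∃[ g ] (∀ h → h ∈ ⟨ g ⟩)

  record IsSubgroup (H : Pred Carrier p) : Set (c ⊔ ℓ ⊔ p) where
    field
      ∈-resp-≈  : H Respects _≈_
      ε-closed  : ε ∈ H
      ∙-closed  : ∀ {g h} → g ∈ H → h ∈ H → g ∙ h ∈ H
      ⁻¹-closed : ∀ {g} → g ∈ H → g ⁻¹ ∈ H

  -- Two subgroups are identified when they have the same elements.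
  subgroupsOfOrder : ℕ → Setoid (lsuc (c ⊔ ℓ)) (c ⊔ ℓ)
  subgroupsOfOrder d =
    subsetoid (≐-setoid Carrier (c ⊔ ℓ))
              (λ H → IsSubgroup H × HasCardinality (subsetoid setoid H) d)

  data UpperCentral : ℕ → Pred Carrier (c ⊔ ℓ) where
    base : ∀ {g} → g ≈ ε → g ∈ UpperCentral zero
    step : ∀ {i g} → (∀ h → ((g ∙ h) ∙ g ⁻¹) ∙ h ⁻¹ ∈ UpperCentral i) →
           g ∈ UpperCentral (suc i)

  IsNilpotent : Set (c ⊔ ℓ)
  IsNilpotent = ∃[ i ] (∀ g → g ∈ UpperCentral i)

  record IsGeneralizedQuaternion (k : ℕ) : Set (c ⊔ ℓ) where
    -- n · g is the n-th power of g; the library's notation is additive.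
    open RawMonoidOperations rawMonoid renaming (_×_ to _·_) using ()
    field
      order     : HasOrder G (2 ^ k)
      x y       : Carrier
      generated : ∀ g → g ∈ Generated (λ h → h ≈ x ⊎ h ≈ y)
      x-power   : (2 ^ (k ∸ 1)) · x ≈ ε
      y-square  : (2 ^ (k ∸ 2)) · x ≈ 2 · y
      conjugate : (y ∙ x) ∙ y ⁻¹ ≈ x ⁻¹

Π : ∀ {m} → (Fin m → Group c ℓ) → Group c ℓ
Π {m = m} P = record
  { Carrier = ∀ i → Group.Carrier (P i)
  ; _≈_     = λ g h → ∀ i → Group._≈_ (P i) (g i) (h i)
  ; _∙_     = λ g h i → Group._∙_ (P i) (g i) (h i)
  ; ε       = λ i → Group.ε (P i)
  ; _⁻¹     = λ g i → Group._⁻¹ (P i) (g i)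
  ; isGroup = record
    { isMonoid = record
      { isSemigroup = record
        { isMagma = record
          { isEquivalence = record
            { refl  = λ i → Group.refl (P i)
            ; sym   = λ g≈h i → Group.sym (P i) (g≈h i)
            ; trans = λ f≈g g≈h i → Group.trans (P i) (f≈g i) (g≈h i)
            }
          ; ∙-cong = λ f≈g h≈k i → Group.∙-cong (P i) (f≈g i) (h≈k i)
          }
        ; assoc = λ f g h i → Group.assoc (P i) (f i) (g i) (h i)
        }
      ; identity = (λ g i → Group.identityˡ (P i) (g i))
                 , (λ g i → Group.identityʳ (P i) (g i))
      }
    ; inverse = (λ g i → Group.inverseˡ (P i) (g i))
              , (λ g i → Group.inverseʳ (P i) (g i))
    ; ⁻¹-cong = λ g≈h i → Group.⁻¹-cong (P i) (g≈h i)
    }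
  }

-- N is the order of Π P.  As p i ^ a is the full power of p i dividing N, the
-- i-th factor is the Sylow (p i)-subgroup of Π P.
record IsOddNilpotentWithNonCyclicSylows
         {m} (P : Fin m → Group c ℓ) (p : Fin m → ℕ) (N : ℕ) : Set (c ⊔ ℓ) where
  field
    order       : HasOrder (Π P) N
    odd         : ¬ (2 ∣ N)
    nilpotent   : IsNilpotent (Π P)
    p-injective : Injective _≡_ _≡_ p
    p-primes    : ∀ q → (Prime q × q ∣ N) ⇔ (∃[ i ] q ≡ p i)
    sylow       : ∀ i → ∃[ a ] (HasOrder (P i) (p i ^ a) ×
                                p i ^ a ∣ N × ¬ (p i ^ suc a ∣ N))
    nonCyclic   : ∀ i → ¬ IsCyclic (P i)

record SimpleGraph v ℓ e : Set (lsuc (v ⊔ ℓ ⊔ e)) where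
  field
    vertices : Setoid v ℓ
  open Setoid vertices public using (_≈_; _≉_) renaming (Carrier to Vertex)
  field
    Adj       : Rel Vertex e
    symmetric : Symmetric Adj
    loopless  : ∀ {u v} → Adj u v → u ≉ v
    respects  : Adj Respects₂ _≈_

module _ (Γ : SimpleGraph v ℓ e) where
  open SimpleGraph Γ

  IsDominatingVertex : Pred Vertex (v ⊔ ℓ ⊔ e)
  IsDominatingVertex u = ∀ w → u ≉ w → Adj u w

  inducedSubgraph : Pred Vertex p → SimpleGraph (v ⊔ p) ℓ e
  inducedSubgraph W = record
    { vertices  = subsetoid vertices W
    ; Adj       = λ u w → Adj (proj₁ u) (proj₁ w)
    ; symmetric = symmetric
    ; loopless  = loopless
    ; respects  = proj₁ respects , proj₂ respects
    }

  IsTotalDominatingSet : Pred Vertex p → Set (v ⊔ e ⊔ p)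
  IsTotalDominatingSet D = ∀ u → ∃[ w ] (w ∈ D × Adj u w)

  -- Subsets range over predicates at a level large enough to contain every
  -- enumerated set of vertices up to ≈.
  record TotalDominatingSetOfSize (d : ℕ) : Set (lsuc (v ⊔ ℓ) ⊔ e) where
    field
      D         : Pred Vertex (v ⊔ ℓ)
      D-resp-≈  : D Respects _≈_
      dominates : IsTotalDominatingSet D
      size      : HasCardinality (subsetoid vertices D) d

  -- γ-strong Γ ≡ d, as a relation: the minimum is attained at d.
  StrongDominationNumber : ℕ → Set (lsuc (v ⊔ ℓ) ⊔ e)
  StrongDominationNumber d =
    TotalDominatingSetOfSize d × (∀ d′ → TotalDominatingSetOfSize d′ → d ≤ d′)

module _ (G : Group c ℓ) where
  open Group G

  enhancedPowerGraph : SimpleGraph c ℓ (c ⊔ ℓ)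
  enhancedPowerGraph = record
    { vertices  = setoid
    ; Adj       = λ u v → u ≉ v × ∃[ w ] (u ∈ ⟨ G ⟩ w × v ∈ ⟨ G ⟩ w)
    ; symmetric = λ (u≉v , w , u∈ , v∈) → (u≉v ∘ sym) , w , v∈ , u∈
    ; loopless  = proj₁
    ; respects  = (λ v≈v′ (u≉v , w , u∈ , v∈) →
                     (λ u≈v′ → u≉v (trans u≈v′ (sym v≈v′))) , w , u∈ , resp v≈v′ v∈)
                , (λ u≈u′ (u≉v , w , u∈ , v∈) →
                     (λ u′≈v → u≉v (trans u≈u′ u′≈v)) , w , resp u≈u′ u∈ , v∈)
    }

  properEnhancedPowerGraph : SimpleGraph (c ⊔ ℓ) ℓ (c ⊔ ℓ)
  properEnhancedPowerGraph =
    inducedSubgraph enhancedPowerGraph (λ u → ¬ IsDominatingVertex enhancedPowerGraph u)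

{-# OPTIONS --safe #-}
module Submission where

-- Send an element to its class in each direct factor: in a noncyclic Sylow subgroup,
-- a nontrivial element has the unique subgroup of order p inside the cyclic group it
-- generates; in Q an element outside ⟨ x ^ 2^(k-2) ⟩ has the unique maximal cyclic
-- subgroup containing it; every other element has no class.  Adjacent vertices agree in
-- every factor in which both have a class, and the dominating vertices are those without
-- any class.
--
-- If Q is the only noncyclic factor, each of its 2^(k-2) + 1 classes is a clique forming
-- a component of its own, which needs two vertices.  Otherwise one representative per
-- class of a factor, plus one vertex supported on another factor, dominate everything.
-- Conversely let D be totally dominating.  If D misses a class in each factor, a vertex
-- with the missed classes is not dominated, so D hits every class of some factor; were
-- there only that many vertices in D, no two of them would be adjacent.
--
-- That each Sylow subgroup has at least two classes is the theorem that a p-group with p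
-- odd and a unique subgroup of order p is cyclic.  It is proved by enlarging a cyclic
-- subgroup ⟨ g ⟩ by an h normalising it with h ^ p = g ^ l: either p ∤ l and h generates
-- more, or some g ^ m h has order p, which contradicts uniqueness.

open import Defs
open import Algebra.Bundles using (Group)
open import Algebra.Construct.DirectProduct using () renaming (group to _×ᴳ_)
import Algebra.Properties.Group as GroupProperties
import Algebra.Properties.Monoid.Mult as Mult
open import Data.Fin as Fin using (Fin) renaming (zero to fzero; suc to fsuc; _≤_ to _≤ᶠ_)
open import Data.Fin.Properties as Finₚ using (any?; all?; ¬∀⟶∃¬; injective⇒≤)
open import Data.Maybe using (Maybe; just; nothing; maybe′)
open import Data.Maybe.Properties using (just-injective; ≡-dec)
open import Data.Nat using (ℕ; zero; suc; _+_; _*_; _∸_; _^_; _≤_; _<_; _⊓_; z≤n; s≤s; NonZero; nonTrivial⇒n>1; _%_; _/_)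
open import Data.Nat.Coprimality as Coprimality using (Coprime; coprime-Bézout; gcd≡1⇒coprime)
open import Data.Nat.Divisibility as Div using (_∣_; divides)
open import Data.Nat.DivMod using (m≡m%n+[m/n]*n; m%n<n; [m+kn]%n≡m%n; m<n⇒m%n≡m)
open import Data.Nat.GCD using (gcd; module Bézout)
open import Data.Nat.Primality using (Prime; prime[2]; prime⇒irreducible; prime⇒nonZero; prime⇒nonTrivial)
import Data.Nat.Properties as ℕₚ
open import Data.Nat.Tactic.RingSolver using (solve-∀)
open import Data.Product using (_×_; _,_; proj₁; proj₂; ∃; ∃₂; ∃-syntax)
open import Data.Sum using (_⊎_; inj₁; inj₂; [_,_]′)
open import Function using (_∘_)
open import Function.Bundles using (Inverse; Equivalence)
open import Function.Definitions using (Injective)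
open import Level using (Level; _⊔_; Lift; lift)
open import Relation.Binary using (Setoid; tri<; tri≈; tri>)
open import Relation.Binary.PropositionalEquality as ≡ using (_≡_; _≢_; cong; subst)
open import Relation.Nullary using (¬_; Dec; yes; no; contradiction; ¬?)
open import Relation.Nullary.Decidable using (_×-dec_; map′; decidable-stable)
open import Relation.Unary using (Pred; _∈_; _⊆_; Decidable; _≐_)

private
  variable
    a c c₁ c₂ ℓ ℓ₁ ℓ₂ v e p : Level

-- Finite index sets and optional classes

injective⇒surjective : ∀ {m n} {f : Fin m → Fin n} → Injective _≡_ _≡_ f → n ≤ m →
                       ∀ y → ∃[ x ] f x ≡ y
injective⇒surjective {m} {suc n} {f} f-injective n≤m y with any? (λ x → f x Fin.≟ y)
... | yes hit = hit
-- A missed value could be punched out of the codomain, leaving an injection of `Fin m` into a set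
-- with fewer than `m` elements.
... | no miss = contradiction (injective⇒≤ avoid-injective) (ℕₚ.<⇒≱ n≤m)
  where
  avoid : Fin m → Fin n
  avoid x = Fin.punchOut {i = y} {j = f x} (λ y≡fx → miss (x , ≡.sym y≡fx))
  avoid-injective : Injective _≡_ _≡_ avoid
  avoid-injective eq = f-injective (Finₚ.punchOut-injective {i = y} _ _ eq)

different : ∀ {n} → 2 ≤ n → (i : Fin n) → ∃[ j ] j ≢ i
different (s≤s (s≤s _)) fzero    = fsuc fzero , λ ()
different (s≤s (s≤s _)) (fsuc i) = fzero , λ ()

just? : {A : Set a} (x : Maybe A) → Dec (∃[ y ] x ≡ just y)
just? (just y) = yes (y , ≡.refl)
just? nothing  = no λ ()

¬just⇒nothing : {A : Set a} {x : Maybe A} → ¬ (∃[ y ] x ≡ just y) → x ≡ nothing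
¬just⇒nothing {x = just y}  ¬just = contradiction (y , ≡.refl) ¬just
¬just⇒nothing {x = nothing} ¬just = ≡.refl

just≢nothing : {A : Set a} {x : Maybe A} {y : A} → x ≡ just y → x ≢ nothing
just≢nothing ≡.refl ()

Compatible : {A : Set a} → Maybe A → Maybe A → Set a
Compatible x y = x ≡ nothing ⊎ y ≡ nothing ⊎ x ≡ y

-- Total domination by families of vertices

module _ (Γ : SimpleGraph v ℓ e) where
  open SimpleGraph Γ

  -- Indexing by `Fin d` turns the counting arguments below into statements about maps between
  -- finite index sets.
  record TotalDominatingFamily (d : ℕ) : Set (v ⊔ ℓ ⊔ e) where
    field
      member    : Fin d → Vertex
      injective : Injective _≡_ _≈_ member
      dominates : ∀ u → ∃[ i ] Adj u (member i)

  set⇒family : ∀ {d} → TotalDominatingSetOfSize Γ d → TotalDominatingFamily d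
  set⇒family T = record
    { member    = λ i → proj₁ (from i)
    ; injective = λ {i} {j} eq →
        ≡.trans (≡.sym (strictlyInverseˡ i)) (≡.trans (to-cong eq) (strictlyInverseˡ j))
    ; dominates = λ u → let w , w∈D , u~w = T.dominates u in
        to (w , w∈D) , proj₁ respects (S.sym (strictlyInverseʳ (w , w∈D))) u~w
    }
    where
    module T = TotalDominatingSetOfSize T
    module S = Setoid vertices
    open Inverse T.size

  family⇒set : ∀ {d} → TotalDominatingFamily d → TotalDominatingSetOfSize Γ d
  family⇒set F = record
    { D         = λ u → Lift v (∃[ i ] u ≈ member i)
    ; D-resp-≈  = λ u≈w (lift (i , u≈i)) → lift (i , S.trans (S.sym u≈w) u≈i)
    ; dominates = λ u → let i , u~i = F.dominates u in member i , lift (i , S.refl) , u~i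
    ; size      = record
      { to        = λ (u , lift (i , _)) → i
      ; from      = λ i → member i , lift (i , S.refl)
      ; to-cong   = λ { {_ , lift (i , u≈i)} {_ , lift (j , w≈j)} u≈w →
                        F.injective (S.trans (S.sym u≈i) (S.trans u≈w w≈j)) }
      ; from-cong = λ { ≡.refl → S.refl }
      ; inverse   = (λ { {i} {_ , lift (j , w≈j)} w≈i → F.injective (S.trans (S.sym w≈j) w≈i) })
                  , (λ { {_ , lift (j , w≈j)} ≡.refl → S.sym w≈j })
      }
    }
    where
    module F = TotalDominatingFamily F
    module S = Setoid vertices
    open F using (member)

  strongDominationNumber : ∀ {d} → TotalDominatingFamily d →
    (∀ {d′} → TotalDominatingFamily d′ → d ≤ d′) → StrongDominationNumber Γ d
  strongDominationNumber F minimal = family⇒set F , λ d′ T → minimal (set⇒family T)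

-- Class systems and clique partitions

module _ (G : Group c ℓ) where
  open Group G

  Joined : Carrier → Carrier → Set (c ⊔ ℓ)
  Joined u v = ∃[ w ] (u ∈ ⟨ G ⟩ w × v ∈ ⟨ G ⟩ w)

  -- class j u is nothing when the j-th component of u constrains no neighbour of u: it is
  -- the identity of a Sylow factor, or central in the quaternion factor.
  record System {K : ℕ} (r : Fin K → ℕ) : Set (c ⊔ ℓ) where
    field
      _≟_            : ∀ u v → Dec (u ≈ v)
      2≤r            : ∀ j → 2 ≤ r j
      class          : ∀ j → Carrier → Maybe (Fin (r j))
      class-cong     : ∀ j {u v} → u ≈ v → class j u ≡ class j v
      rep            : (∀ j → Maybe (Fin (r j))) → Carrier
      class-rep      : ∀ f j → class j (rep f) ≡ f j
      joined-class   : ∀ j {u v a b} → Joined u v →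
                       class j u ≡ just a → class j v ≡ just b → a ≡ b
      joined-rep     : ∀ {u f} → (∀ j → Compatible (class j u) (f j)) → Joined u (rep f)
      trivial-joined : ∀ {u} → (∀ j → class j u ≡ nothing) → ∀ v → Joined u v

  -- Here every class is a clique, and a component of its own once the elements without class are
  -- deleted. Two distinct members, `rep` and `twin`, are recorded because a vertex does not
  -- dominate itself.
  record CliquePartition (r : ℕ) : Set (c ⊔ ℓ) where
    field
      _≟_            : ∀ u v → Dec (u ≈ v)
      2≤r            : 2 ≤ r
      class          : Carrier → Maybe (Fin r)
      class-cong     : ∀ {u v} → u ≈ v → class u ≡ class v
      rep twin       : Fin r → Carrier
      class-rep      : ∀ i → class (rep i) ≡ just i
      class-twin     : ∀ i → class (twin i) ≡ just i
      rep≉twin       : ∀ i → rep i ≉ twin i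
      joined-class   : ∀ {u v a b} → Joined u v → class u ≡ just a → class v ≡ just b → a ≡ b
      clique         : ∀ {u v a} → class u ≡ just a → class v ≡ just a → Joined u v
      trivial-joined : ∀ {u} → class u ≡ nothing → ∀ v → Joined u v

-- Fed to `rep`, this profile gives an element supported on the single factor `j`.
only : ∀ {K} {r : Fin K → ℕ} (j : Fin K) → Fin (r j) → ∀ i → Maybe (Fin (r i))
only j a i with j Fin.≟ i
... | yes ≡.refl = just a
... | no _       = nothing

only-≡ : ∀ {K} {r : Fin K → ℕ} j (a : Fin (r j)) → only {r = r} j a j ≡ just a
only-≡ j a with j Fin.≟ j
... | yes ≡.refl = ≡.refl
... | no j≢j     = contradiction ≡.refl j≢j

only-≢ : ∀ {K} {r : Fin K → ℕ} {j i} (a : Fin (r j)) → j ≢ i → only {r = r} j a i ≡ nothing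
only-≢ {j = j} {i} a j≢i with j Fin.≟ i
... | yes j≡i = contradiction j≡i j≢i
... | no _    = ≡.refl

-- Domination number of a class system

module _ {G : Group c ℓ} {K} {r : Fin K → ℕ} (S : System G r) where
  open Group G
  open System S
  private
    Γ = properEnhancedPowerGraph G
    module Γ = SimpleGraph Γ

  -- Factor `j` has a second class, and an element of that class is not joined to `u`, so `u` is not
  -- deleted.
  nontrivial-vertex : ∀ {u j a} → class j u ≡ just a → Γ.Vertex
  nontrivial-vertex {u} {j} {a} ju≡a = u , λ dominating →
    let b , b≢a   = different (2≤r j) a
        jw≡b      = ≡.trans (class-rep (only j b) j) (only-≡ j b)
        u≉w       = λ u≈w → b≢a (just-injective
                      (≡.trans (≡.sym jw≡b) (≡.trans (≡.sym (class-cong j u≈w)) ju≡a)))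
        _ , u—w   = dominating (rep (only j b)) u≉w
    in b≢a (≡.sym (joined-class j u—w ju≡a jw≡b))

  -- An element with no class in any factor is joined to everything, hence was deleted as
  -- dominating.
  vertex-nontrivial : (u : Γ.Vertex) → ∃₂ λ j a → class j (proj₁ u) ≡ just a
  vertex-nontrivial (u , ¬dominating) with any? (λ j → just? (class j u))
  ... | yes nontrivial = nontrivial
  ... | no trivial     = contradiction
    (λ w u≉w → u≉w , trivial-joined (λ j → ¬just⇒nothing (λ just-a → trivial (j , just-a))) w)
    ¬dominating

  first : ∀ j → Fin (r j)
  first j = Fin.fromℕ< (ℕₚ.<⇒≤ (2≤r j))

  -- The representatives of the classes of `j₀` dominate every vertex other than themselves; the
  -- extra vertex, supported on `j₁`, dominates the representatives.
  representatives-dominate : ∀ {j₀ j₁} → j₀ ≢ j₁ → TotalDominatingFamily Γ (suc (r j₀))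
  representatives-dominate {j₀} {j₁} j₀≢j₁ = record
    { member    = members
    ; injective = λ
      { {fzero}  {fzero}  _  → ≡.refl
      ; {fzero}  {fsuc b} eq → contradiction (≡.trans (≡.sym (class-cong j₀ eq)) j₀-zero) (just≢nothing (j₀-suc b))
      ; {fsuc a} {fzero}  eq → contradiction (≡.trans (class-cong j₀ eq) j₀-zero) (just≢nothing (j₀-suc a))
      ; {fsuc a} {fsuc b} eq → cong fsuc (just-injective
          (≡.trans (≡.sym (j₀-suc a)) (≡.trans (class-cong j₀ eq) (j₀-suc b))))
      }
    ; dominates = dominate
    }
    where
    point : ∀ j → Fin (r j) → Γ.Vertex
    point j a = nontrivial-vertex (≡.trans (class-rep (only j a) j) (only-≡ j a))
    j₀-zero : class j₀ (rep (only j₁ (first j₁))) ≡ nothing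
    j₀-zero = ≡.trans (class-rep _ j₀) (only-≢ (first j₁) (j₀≢j₁ ∘ ≡.sym))
    j₀-suc : ∀ a → class j₀ (rep (only j₀ a)) ≡ just a
    j₀-suc a = ≡.trans (class-rep _ j₀) (only-≡ j₀ a)
    compatible : ∀ {u} j a → Compatible (class j u) (just a) → ∀ i → Compatible (class i u) (only j a i)
    compatible j a j-compatible i with j Fin.≟ i
    ... | yes ≡.refl = j-compatible
    ... | no _       = inj₂ (inj₁ ≡.refl)
    members : Fin (suc (r j₀)) → Γ.Vertex
    members fzero    = point j₁ (first j₁)
    members (fsuc a) = point j₀ a
    dominate : ∀ u → ∃[ i ] Γ.Adj u (members i)
    dominate (u , _) with class j₀ u in j₀u
    ... | nothing = fsuc (first j₀) ,
      (λ u≈w → just≢nothing (≡.trans (class-cong j₀ u≈w) (j₀-suc _)) j₀u) ,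
      joined-rep (compatible j₀ _ (inj₁ j₀u))
    ... | just a with u ≟ rep (only j₀ a)
    ...   | no u≉w  = fsuc a , u≉w , joined-rep (compatible j₀ a (inj₂ (inj₂ j₀u)))
    -- A representative has no class at `j₁`, so it is joined to the extra vertex; the two differ
    -- because the extra vertex has no class at `j₀`.
    ...   | yes u≈w = fzero ,
      (λ u≈w → just≢nothing j₀u (≡.trans (class-cong j₀ u≈w) j₀-zero)) ,
      joined-rep (compatible j₁ _ (inj₁ (≡.trans (class-cong j₁ u≈w)
                                        (≡.trans (class-rep _ j₁) (only-≢ a j₀≢j₁)))))

  module _ {d} (F : TotalDominatingFamily Γ d) where
    open TotalDominatingFamily F

    private
      classOf : ∀ j → Fin d → Maybe (Fin (r j))
      classOf j i = class j (proj₁ (member i))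

      hit? : ∀ j (a : Fin (r j)) → Dec (∃[ i ] classOf j i ≡ just a)
      hit? j a = any? (λ i → ≡-dec Fin._≟_ (classOf j i) (just a))

    -- Otherwise each factor has a missed class, and `u` combines them. Its neighbour in the family
    -- has a class in some factor `j`, and adjacency forces that class to be the missed one. The
    -- argument `j₀` names a factor in which `u` is nontrivial, which makes `u` a vertex.
    some-coordinate-hit : Fin K → ∃[ j ] (∀ a → ∃[ i ] classOf j i ≡ just a)
    some-coordinate-hit j₀ with any? (λ j → all? (hit? j))
    ... | yes hit = hit
    ... | no ¬hit = contradiction b≡missed b≢missed
      where
      missed : ∀ j → ∃[ a ] ¬ (∃[ i ] classOf j i ≡ just a)
      missed j = ¬∀⟶∃¬ (r j) _ (hit? j) (λ all → ¬hit (j , all))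
      u : Carrier
      u = rep (λ j → just (proj₁ (missed j)))
      neighbour = dominates (nontrivial-vertex {u} {j₀} (class-rep _ j₀))
      i = proj₁ neighbour
      nontrivial = vertex-nontrivial (member i)
      j = proj₁ nontrivial
      b≡missed = joined-class j (proj₂ (proj₂ neighbour)) (class-rep _ j) (proj₂ (proj₂ nontrivial))
      b≢missed = λ eq → proj₂ (missed j)
        (i , ≡.trans (proj₂ (proj₂ nontrivial)) (cong just (≡.sym eq)))

    -- If r j members hit all r j classes of j, distinct members have distinct classes
    -- there, so no member is dominated.
    coordinate-hit⇒< : ∀ j → (∀ a → ∃[ i ] classOf j i ≡ just a) → r j < d
    coordinate-hit⇒< j hit with d ℕₚ.≤? r j
    ... | no d≰r  = ℕₚ.≰⇒> d≰r
    ... | yes d≤r = contradiction (reflexive (cong (proj₁ ∘ member) (same-index _ neighbour-class)))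
                                  (proj₁ (proj₂ neighbour))
      where
      choose : Fin (r j) → Fin d
      choose a = proj₁ (hit a)
      choose-class : ∀ a → classOf j (choose a) ≡ just a
      choose-class a = proj₂ (hit a)
      choose-injective : Injective _≡_ _≡_ choose
      choose-injective {a} {b} eq = just-injective
        (≡.trans (≡.sym (choose-class a)) (≡.trans (cong (classOf j) eq) (choose-class b)))
      i₁ = choose (first j)
      neighbour = dominates (member i₁)
      same-index : ∀ i → (∀ {b} → classOf j i ≡ just b → first j ≡ b) → i₁ ≡ i
      same-index i eq with a , ≡.refl ← injective⇒surjective choose-injective d≤r i =
        cong choose (eq (choose-class a))
      neighbour-class : ∀ {b} → classOf j (proj₁ neighbour) ≡ just b → first j ≡ b
      neighbour-class = joined-class j (proj₂ (proj₂ neighbour)) (choose-class (first j))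

  minimal-coordinate-number : ∀ {j₀ j₁} → j₀ ≢ j₁ → (∀ j → r j₀ ≤ r j) →
                              StrongDominationNumber Γ (suc (r j₀))
  minimal-coordinate-number {j₀} j₀≢j₁ minimal =
    strongDominationNumber Γ (representatives-dominate j₀≢j₁) λ F →
      let j , hit = some-coordinate-hit F j₀ in
      ℕₚ.≤-trans (s≤s (minimal j)) (coordinate-hit⇒< F j hit)

-- Domination number of a clique partition

module _ {G : Group c ℓ} {r} (S : CliquePartition G r) where
  open Group G
  open CliquePartition S
  private
    Γ = properEnhancedPowerGraph G
    module Γ = SimpleGraph Γ

    splitAt-injective : Injective _≡_ _≡_ (Fin.splitAt r {r})
    splitAt-injective {i} {j} eq = ≡.trans (≡.sym (Finₚ.join-splitAt r r i))
      (≡.trans (cong (Fin.join r r) eq) (Finₚ.join-splitAt r r j))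

    different-class : ∀ {u v a b} → class u ≡ just a → class v ≡ just b → u ≈ v → a ≡ b
    different-class ua vb u≈v =
      just-injective (≡.trans (≡.sym ua) (≡.trans (class-cong u≈v) vb))

  clique-vertex : ∀ {u a} → class u ≡ just a → Γ.Vertex
  clique-vertex {u} {a} u≡a = u , λ dominating →
    let b , b≢a = different 2≤r a
        _ , u—w = dominating (rep b) (λ u≈w → b≢a (≡.sym (different-class u≡a (class-rep b) u≈w)))
    in b≢a (≡.sym (joined-class u—w u≡a (class-rep b)))

  clique-vertex-nontrivial : (u : Γ.Vertex) → ∃[ a ] class (proj₁ u) ≡ just a
  clique-vertex-nontrivial (u , ¬dominating) with just? (class u)
  ... | yes nontrivial = nontrivial
  ... | no trivial     = contradiction
    (λ w u≉w → u≉w , trivial-joined (¬just⇒nothing trivial) w) ¬dominating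

  -- `rep a` dominates the rest of class `a`, and `twin a` dominates `rep a`.
  twins-dominate : TotalDominatingFamily Γ (r + r)
  twins-dominate = record
    { member    = members ∘ Fin.splitAt r
    ; injective = splitAt-injective ∘ members-injective
    ; dominates = λ u → let s , u~s = dominate u in
        Fin.join r r s , subst (Γ.Adj u ∘ members) (≡.sym (Finₚ.splitAt-join r r s)) u~s
    }
    where
    members : Fin r ⊎ Fin r → Γ.Vertex
    members = [ clique-vertex ∘ class-rep , clique-vertex ∘ class-twin ]′
    members-injective : ∀ {s t} → members s Γ.≈ members t → s ≡ t
    members-injective {inj₁ a} {inj₁ b} eq = cong inj₁ (different-class (class-rep a) (class-rep b) eq)
    members-injective {inj₂ a} {inj₂ b} eq = cong inj₂ (different-class (class-twin a) (class-twin b) eq)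
    members-injective {inj₁ a} {inj₂ b} eq
      with ≡.refl ← different-class (class-rep a) (class-twin b) eq = contradiction eq (rep≉twin a)
    members-injective {inj₂ a} {inj₁ b} eq
      with ≡.refl ← different-class (class-twin a) (class-rep b) eq = contradiction (sym eq) (rep≉twin a)
    dominate : ∀ u → ∃[ s ] Γ.Adj u (members s)
    dominate u@(x , _) with a , xa ← clique-vertex-nontrivial u | x ≟ rep a
    ... | no x≉rep  = inj₁ a , x≉rep , clique xa (class-rep a)
    ... | yes x≈rep = inj₂ a , (λ x≈twin → rep≉twin a (trans (sym x≈rep) x≈twin)) ,
                      clique xa (class-twin a)

  -- For each class `a`, a dominator of `rep a` and a dominator of that dominator both lie in class
  -- `a`, and they differ because they are adjacent. This yields two members per class.
  clique-number-≤ : ∀ {d} → TotalDominatingFamily Γ d → r + r ≤ d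
  clique-number-≤ {d} F = injective⇒≤ {f = pair ∘ Fin.splitAt r} (splitAt-injective ∘ pair-injective)
    where
    open TotalDominatingFamily F
    classOf : Fin d → Maybe (Fin r)
    classOf i = class (proj₁ (member i))
    neighbour-class : ∀ {u a} → class (proj₁ u) ≡ just a → classOf (proj₁ (dominates u)) ≡ just a
    neighbour-class {u} ua =
      let i , _ , u—i = dominates u
          b , ib      = clique-vertex-nontrivial (member i)
      in ≡.trans ib (cong just (≡.sym (joined-class u—i ua ib)))
    pair : Fin r ⊎ Fin r → Fin d
    pair (inj₁ a) = proj₁ (dominates (clique-vertex (class-rep a)))
    pair (inj₂ a) = proj₁ (dominates (member (pair (inj₁ a))))
    pair-class₁ : ∀ a → classOf (pair (inj₁ a)) ≡ just a
    pair-class₁ a = neighbour-class {clique-vertex (class-rep a)} (class-rep a)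
    pair-class₂ : ∀ a → classOf (pair (inj₂ a)) ≡ just a
    pair-class₂ a = neighbour-class {member (pair (inj₁ a))} (pair-class₁ a)
    pair₁≢pair₂ : ∀ a → pair (inj₁ a) ≢ pair (inj₂ a)
    pair₁≢pair₂ a eq = proj₁ (proj₂ (dominates (member (pair (inj₁ a)))))
                             (reflexive (cong (proj₁ ∘ member) eq))
    same-class : ∀ {i j a b} → classOf i ≡ just a → classOf j ≡ just b → i ≡ j → a ≡ b
    same-class ia jb i≡j = just-injective (≡.trans (≡.sym ia) (≡.trans (cong classOf i≡j) jb))
    pair-injective : ∀ {s t} → pair s ≡ pair t → s ≡ t
    pair-injective {inj₁ a} {inj₁ b} eq = cong inj₁ (same-class (pair-class₁ a) (pair-class₁ b) eq)
    pair-injective {inj₂ a} {inj₂ b} eq = cong inj₂ (same-class (pair-class₂ a) (pair-class₂ b) eq)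
    pair-injective {inj₁ a} {inj₂ b} eq
      with ≡.refl ← same-class (pair-class₁ a) (pair-class₂ b) eq = contradiction eq (pair₁≢pair₂ a)
    pair-injective {inj₂ a} {inj₁ b} eq
      with ≡.refl ← same-class (pair-class₂ a) (pair-class₁ b) eq = contradiction (≡.sym eq) (pair₁≢pair₂ a)

  clique-number : StrongDominationNumber Γ (r + r)
  clique-number = strongDominationNumber Γ twins-dominate clique-number-≤

-- Congruences

infix 4 _≡_[mod_]

-- Multiples of `e` are added on both sides so that congruence of natural numbers needs no
-- subtraction.
_≡_[mod_] : ℕ → ℕ → ℕ → Set
a ≡ b [mod e ] = ∃₂ λ x y → a + x * e ≡ b + y * e

mod-refl : ∀ {a e} → a ≡ a [mod e ]
mod-refl = 0 , 0 , ≡.refl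

mod-sym : ∀ {a b e} → a ≡ b [mod e ] → b ≡ a [mod e ]
mod-sym (x , y , eq) = y , x , ≡.sym eq

mod-trans : ∀ {a b c e} → a ≡ b [mod e ] → b ≡ c [mod e ] → a ≡ c [mod e ]
mod-trans {a} {b} {c} {e} (x , y , eq) (x′ , y′ , eq′) = x + x′ , y + y′ , (begin
  a + (x + x′) * e     ≡⟨ shift a x x′ e ⟩
  a + x * e + x′ * e   ≡⟨ cong (λ s → s + x′ * e) eq ⟩
  b + y * e + x′ * e   ≡⟨ swap b y x′ e ⟩
  b + x′ * e + y * e   ≡⟨ cong (λ s → s + y * e) eq′ ⟩
  c + y′ * e + y * e   ≡⟨ swap c y′ y e ⟩
  c + y * e + y′ * e   ≡⟨ shift c y y′ e ⟨
  c + (y + y′) * e     ∎)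
  where
  open ≡.≡-Reasoning
  shift : ∀ a x y e → a + (x + y) * e ≡ a + x * e + y * e
  shift = solve-∀
  swap : ∀ a x y e → a + x * e + y * e ≡ a + y * e + x * e
  swap = solve-∀

mod-+ : ∀ {a b c d e} → a ≡ b [mod e ] → c ≡ d [mod e ] → a + c ≡ b + d [mod e ]
mod-+ {a} {b} {c} {d} {e} (x , y , eq) (x′ , y′ , eq′) = x + x′ , y + y′ , (begin
  a + c + (x + x′) * e           ≡⟨ regroup a c x x′ e ⟩
  (a + x * e) + (c + x′ * e)     ≡⟨ ≡.cong₂ _+_ eq eq′ ⟩
  (b + y * e) + (d + y′ * e)     ≡⟨ regroup b d y y′ e ⟨
  b + d + (y + y′) * e           ∎)
  where
  open ≡.≡-Reasoning
  regroup : ∀ a c x y e → a + c + (x + y) * e ≡ (a + x * e) + (c + y * e)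
  regroup = solve-∀

mod-*ˡ : ∀ {a b e} c → a ≡ b [mod e ] → c * a ≡ c * b [mod e ]
mod-*ˡ {a} {b} {e} c (x , y , eq) = c * x , c * y ,
  ≡.trans (factor c a x e) (≡.trans (cong (c *_) eq) (≡.sym (factor c b y e)))
  where
  factor : ∀ c a x e → c * a + c * x * e ≡ c * (a + x * e)
  factor = solve-∀

multiple-mod : ∀ k {e} → k * e ≡ 0 [mod e ]
multiple-mod k = 0 , k , ℕₚ.+-identityʳ _

mod-∣ : ∀ {a b d e} → d ∣ e → a ≡ b [mod e ] → a ≡ b [mod d ]
mod-∣ {a} {b} {d} (divides q ≡.refl) (x , y , eq) = x * q , y * q ,
  ≡.trans (cong (a +_) (ℕₚ.*-assoc x q d)) (≡.trans eq (cong (b +_) (≡.sym (ℕₚ.*-assoc y q d))))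

mod⇒% : ∀ {a b e} .{{_ : NonZero e}} → a ≡ b [mod e ] → a % e ≡ b % e
mod⇒% {a} {b} {e} (x , y , eq) =
  ≡.trans (≡.sym ([m+kn]%n≡m%n a x e)) (≡.trans (cong (_% e) eq) ([m+kn]%n≡m%n b y e))

%-mod : ∀ a e .{{_ : NonZero e}} → a % e ≡ a [mod e ]
%-mod a e = a / e , 0 , ≡.trans (≡.sym (m≡m%n+[m/n]*n a e)) (≡.sym (ℕₚ.+-identityʳ a))

abstract
  mod-inverse : ∀ {l e} .{{_ : NonZero e}} → Coprime l e → ∃[ l′ ] l′ * l ≡ 1 [mod e ]
  mod-inverse {l} {e@(suc f)} coprime with coprime-Bézout coprime
  ... | Bézout.Identity.+- x y eq = x , 0 , y , ≡.trans (ℕₚ.+-identityʳ (x * l)) (≡.sym eq)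
  -- Here `1 + x * l ≡ y * e`, so `x * l` is -1 modulo `e`; the factor `f`, with `e = 1 + f`, is -1
  -- as well.
  ... | Bézout.Identity.-+ x y eq = x * f , 1 , y * f , (begin
    x * f * l + 1 * (1 + f)   ≡⟨ regroup x l f ⟩
    (1 + x * l) * f + 1       ≡⟨ cong (λ t → t * f + 1) eq ⟩
    y * (1 + f) * f + 1       ≡⟨ regroup′ y f ⟩
    1 + y * f * (1 + f)       ∎)
    where
    open ≡.≡-Reasoning
    regroup : ∀ x l f → x * f * l + 1 * (1 + f) ≡ (1 + x * l) * f + 1
    regroup = solve-∀
    regroup′ : ∀ y f → y * (1 + f) * f + 1 ≡ 1 + y * f * (1 + f)
    regroup′ = solve-∀

-- Coprimality and the Chinese remainder theorem

coprime-* : ∀ {m n o} → Coprime m o → Coprime n o → Coprime (m * n) o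
coprime-* {m} {n} {o} m⊥o n⊥o {d} (d∣mn , d∣o) = n⊥o (Coprimality.coprime-divisor d⊥m d∣mn , d∣o)
  where
  d⊥m : Coprime d m
  d⊥m (x∣d , x∣m) = m⊥o (x∣m , Div.∣-trans x∣d d∣o)

coprime-^ : ∀ {m o} k → Coprime m o → Coprime (m ^ k) o
coprime-^ zero    m⊥o (d∣1 , _) = Div.∣1⇒≡1 d∣1
coprime-^ (suc k) m⊥o = coprime-* m⊥o (coprime-^ k m⊥o)

abstract
  crt₂ : ∀ {d e} .{{_ : NonZero d}} .{{_ : NonZero e}} → Coprime d e →
         ∀ s t → ∃[ z ] (z ≡ s [mod d ] × z ≡ t [mod e ])
  crt₂ {d} {e} d⊥e s t = z ,
    mod-trans (mod-+ (mod-*ˡ s (proj₂ e⁻¹)) (mod-trans (mod-*ˡ t (multiple-mod (proj₁ d⁻¹))) (unit₀ t)))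
              (subst (_≡ s [mod d ]) (≡.sym (units s)) mod-refl) ,
    mod-trans (mod-+ (mod-trans (mod-*ˡ s (multiple-mod (proj₁ e⁻¹))) (unit₀ s)) (mod-*ˡ t (proj₂ d⁻¹)))
              (subst (_≡ t [mod e ]) (≡.sym (ℕₚ.*-identityʳ t)) mod-refl)
    where
    d⁻¹ : ∃[ d⁻¹ ] d⁻¹ * d ≡ 1 [mod e ]
    d⁻¹ = mod-inverse d⊥e
    e⁻¹ : ∃[ e⁻¹ ] e⁻¹ * e ≡ 1 [mod d ]
    e⁻¹ = mod-inverse (Coprimality.sym d⊥e)
    z : ℕ
    z = s * (proj₁ e⁻¹ * e) + t * (proj₁ d⁻¹ * d)
    unit₀ : ∀ t {e} → t * 0 ≡ 0 [mod e ]
    unit₀ t {e} = subst (_≡ 0 [mod e ]) (≡.sym (ℕₚ.*-zeroʳ t)) mod-refl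
    units : ∀ s → s * 1 + 0 ≡ s
    units = solve-∀

-- A solution of the congruences, bundled with a common multiple of the moduli that is coprime to
-- any `o` coprime to all of them. The field `coprime` lets the induction in `crt` adjoin one more
-- modulus.
record Modulus {n} (e : Fin n → ℕ) (s : Fin n → ℕ) : Set where
  field
    modulus   : ℕ
    nonZero   : NonZero modulus
    divisible : ∀ i → e i ∣ modulus
    coprime   : ∀ {o} → (∀ i → Coprime (e i) o) → Coprime modulus o
    solution  : ℕ
    solves    : ∀ i → solution ≡ s i [mod e i ]

abstract
  crt : ∀ {n} (e : Fin n → ℕ) → (∀ i → NonZero (e i)) → (∀ {i j} → i ≢ j → Coprime (e i) (e j)) →
        (s : Fin n → ℕ) → Modulus e s
  crt {zero}  e e≢0 e⊥e s = record
    { modulus = 1 ; nonZero = _ ; divisible = λ () ; coprime = λ _ (d∣1 , _) → Div.∣1⇒≡1 d∣1 ; solution = 0 ; solves = λ () }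
  crt {suc n} e e≢0 e⊥e s = record
    { modulus   = e fzero * modulus
    ; nonZero   = ℕₚ.m*n≢0 (e fzero) modulus {{e≢0 fzero}} {{nonZero}}
    ; divisible = λ { fzero → Div.m∣m*n modulus ; (fsuc i) → Div.∣n⇒∣m*n (e fzero) (divisible i) }
    ; coprime   = λ e⊥o → coprime-* (e⊥o fzero) (coprime (e⊥o ∘ fsuc))
    ; solution  = proj₁ combined
    ; solves    = λ { fzero    → proj₁ (proj₂ combined)
                    ; (fsuc i) → mod-trans (mod-∣ (divisible i) (proj₂ (proj₂ combined))) (solves i) }
    }
    where
    open Modulus (crt (e ∘ fsuc) (e≢0 ∘ fsuc) (λ i≢j → e⊥e (i≢j ∘ Finₚ.suc-injective)) (s ∘ fsuc))
    combined : ∃[ z ] (z ≡ s fzero [mod e fzero ] × z ≡ solution [mod modulus ])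
    combined = crt₂ {{e≢0 fzero}} {{nonZero}} (Coprimality.sym (coprime (λ i → e⊥e {fsuc i} {fzero} λ ()))) (s fzero) solution

abstract
  least : {P : Pred ℕ p} → Decidable P → ∀ {n} → P n → ∃[ o ] (P o × (∀ {j} → j < o → ¬ P j))
  least {P = P} P? {n} Pn with search (suc n)
    where
    search : ∀ m → (∃[ o ] (P o × (∀ {j} → j < o → ¬ P j))) ⊎ (∀ {j} → j < m → ¬ P j)
    search zero    = inj₂ λ ()
    search (suc m) with search m | P? m
    ... | inj₁ found | _      = inj₁ found
    ... | inj₂ none  | yes Pm = inj₁ (m , Pm , none)
    ... | inj₂ none  | no ¬Pm = inj₂ λ j<1+m → [ none , (λ { ≡.refl → ¬Pm }) ]′ (ℕₚ.m<1+n⇒m<n∨m≡n j<1+m)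
  ... | inj₁ found = found
  ... | inj₂ none  = contradiction Pn (none ℕₚ.≤-refl)

-- Finite groups

module Powers (G : Group c ℓ) where
  open Group G
  open Mult monoid public renaming (_×_ to infixr 7.5 _·_)
    using (×-congʳ; ×-congˡ; ×-homo-+; ×-homo-1; ×-assocˡ)
  open GroupProperties G public
  open import Relation.Binary.Reasoning.Setoid setoid

  ·-ε : ∀ m → m · ε ≈ ε
  ·-ε zero    = refl
  ·-ε (suc m) = trans (identityˡ _) (·-ε m)

  ·-comm : ∀ m n u → m · (n · u) ≈ n · (m · u)
  ·-comm m n u = begin
    m · (n · u)  ≈⟨ ×-assocˡ u m n ⟩
    (m * n) · u  ≈⟨ ×-congˡ (ℕₚ.*-comm m n) ⟩
    (n * m) · u  ≈⟨ ×-assocˡ u n m ⟨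
    n · (m · u)  ∎

  mod-· : ∀ {e a b u} → e · u ≈ ε → a ≡ b [mod e ] → a · u ≈ b · u
  mod-· {e} {a} {b} {u} e·u≈ε (x , y , eq) = begin
    a · u            ≈⟨ reduce a x ⟨
    (a + x * e) · u  ≈⟨ ×-congˡ eq ⟩
    (b + y * e) · u  ≈⟨ reduce b y ⟩
    b · u            ∎
    where
    reduce : ∀ a x → (a + x * e) · u ≈ a · u
    reduce a x = begin
      (a + x * e) · u       ≈⟨ ×-homo-+ u a (x * e) ⟩
      a · u ∙ (x * e) · u   ≈⟨ ∙-congˡ (×-assocˡ u x e) ⟨
      a · u ∙ x · (e · u)   ≈⟨ ∙-congˡ (×-congʳ x e·u≈ε) ⟩
      a · u ∙ x · ε         ≈⟨ ∙-congˡ (·-ε x) ⟩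
      a · u ∙ ε             ≈⟨ identityʳ _ ⟩
      a · u                 ∎

  abstract
    coprime-root : ∀ {l e u} .{{_ : NonZero e}} → e · u ≈ ε → Coprime l e → ∃[ l′ ] l′ · (l · u) ≈ u
    coprime-root {l} {u = u} e·u≈ε l⊥e = let l′ , eq = mod-inverse l⊥e in
      l′ , trans (×-assocˡ u l′ l) (trans (mod-· e·u≈ε eq) (×-homo-1 u))

  power∈ : ∀ n w → n · w ∈ ⟨ G ⟩ w
  power∈ zero    w = one
  power∈ (suc n) w = mul (gen refl) (power∈ n w)

  ⟨⟩-trans : ∀ {u v w} → u ∈ ⟨ G ⟩ v → v ∈ ⟨ G ⟩ w → u ∈ ⟨ G ⟩ w
  ⟨⟩-trans (gen u≈v)    v∈w = resp (sym u≈v) v∈w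
  ⟨⟩-trans (resp eq u∈) v∈w = resp eq (⟨⟩-trans u∈ v∈w)
  ⟨⟩-trans one          v∈w = one
  ⟨⟩-trans (mul u∈ t∈)  v∈w = mul (⟨⟩-trans u∈ v∈w) (⟨⟩-trans t∈ v∈w)
  ⟨⟩-trans (inv u∈)     v∈w = inv (⟨⟩-trans u∈ v∈w)

  conjugate : Carrier → Carrier → Carrier
  conjugate h g = (h ∙ g) ∙ h ⁻¹

  conjugate-∙ : ∀ h k g → conjugate (h ∙ k) g ≈ conjugate h (conjugate k g)
  conjugate-∙ h k g = begin
    ((h ∙ k) ∙ g) ∙ (h ∙ k) ⁻¹      ≈⟨ ∙-cong (assoc h k g) (⁻¹-anti-homo-∙ h k) ⟩
    (h ∙ (k ∙ g)) ∙ (k ⁻¹ ∙ h ⁻¹)   ≈⟨ assoc _ _ _ ⟨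
    ((h ∙ (k ∙ g)) ∙ k ⁻¹) ∙ h ⁻¹   ≈⟨ ∙-congʳ (assoc h (k ∙ g) (k ⁻¹)) ⟩
    (h ∙ ((k ∙ g) ∙ k ⁻¹)) ∙ h ⁻¹   ∎

  conjugate-· : ∀ h u n → conjugate h (n · u) ≈ n · conjugate h u
  conjugate-· h u zero    = trans (∙-congʳ (identityʳ h)) (inverseʳ h)
  conjugate-· h u (suc n) = begin
    (h ∙ (u ∙ n · u)) ∙ h ⁻¹                 ≈⟨ ∙-congʳ (assoc h u (n · u)) ⟨
    ((h ∙ u) ∙ n · u) ∙ h ⁻¹                 ≈⟨ ∙-congʳ (∙-congˡ (\\-leftDividesʳ h (n · u))) ⟨
    ((h ∙ u) ∙ (h ⁻¹ ∙ (h ∙ n · u))) ∙ h ⁻¹  ≈⟨ ∙-congʳ (assoc (h ∙ u) (h ⁻¹) _) ⟨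
    (((h ∙ u) ∙ h ⁻¹) ∙ (h ∙ n · u)) ∙ h ⁻¹  ≈⟨ assoc _ _ _ ⟩
    ((h ∙ u) ∙ h ⁻¹) ∙ ((h ∙ n · u) ∙ h ⁻¹)  ≈⟨ ∙-congˡ (conjugate-· h u n) ⟩
    ((h ∙ u) ∙ h ⁻¹) ∙ n · ((h ∙ u) ∙ h ⁻¹)  ∎

  move-past : ∀ {g h s} → conjugate h g ≈ s · g → ∀ n → h ∙ n · g ≈ (n * s) · g ∙ h
  move-past {g} {h} {s} hgh⁻¹≈ n = begin
    h ∙ n · g                 ≈⟨ //-rightDividesˡ h (h ∙ n · g) ⟨
    conjugate h (n · g) ∙ h   ≈⟨ ∙-congʳ (conjugate-· h g n) ⟩
    n · conjugate h g ∙ h     ≈⟨ ∙-congʳ (×-congʳ n hgh⁻¹≈) ⟩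
    n · (s · g) ∙ h           ≈⟨ ∙-congʳ (×-assocˡ g n s) ⟩
    (n * s) · g ∙ h           ∎

module _ {G : Group c ℓ} {H : Group v e} where
  private
    module G = Group G
    module H = Group H

  map-⟨⟩ : (φ : G.Carrier → H.Carrier) → (∀ {u v} → u G.≈ v → φ u H.≈ φ v) →
           φ G.ε H.≈ H.ε → (∀ u v → φ u H.∙ φ v H.≈ φ (u G.∙ v)) → (∀ u → φ u H.⁻¹ H.≈ φ (u G.⁻¹)) →
           ∀ {u w} → u ∈ ⟨ G ⟩ w → φ u ∈ ⟨ H ⟩ (φ w)
  map-⟨⟩ φ φ-cong φ-ε φ-∙ φ-⁻¹ = go
    where
    go : ∀ {u w} → u ∈ ⟨ G ⟩ w → φ u ∈ ⟨ H ⟩ (φ w)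
    go (gen u≈w)    = gen (φ-cong u≈w)
    go (resp eq u∈) = resp (φ-cong eq) (go u∈)
    go one          = resp (H.sym φ-ε) one
    go (mul u∈ v∈)  = resp (φ-∙ _ _) (mul (go u∈) (go v∈))
    go (inv u∈)     = resp (φ-⁻¹ _) (inv (go u∈))

module Finite (G : Group c ℓ) (n : ℕ) (|G| : HasOrder G n) where
  open Group G
  open Powers G
  open Inverse |G| using (to; from; to-cong; strictlyInverseˡ; strictlyInverseʳ)
  open import Relation.Binary.Reasoning.Setoid setoid

  infix 4 _≟_

  to-injective : ∀ {u v} → to u ≡ to v → u ≈ v
  to-injective {u} {v} eq =
    trans (sym (strictlyInverseʳ u)) (trans (reflexive (cong from eq)) (strictlyInverseʳ v))

  _≟_ : ∀ u v → Dec (u ≈ v)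
  u ≟ v = map′ to-injective to-cong (to u Fin.≟ to v)

  search : {P : Pred Carrier p} → (∀ {u v} → u ≈ v → P u → P v) → Decidable P → Dec (∃ P)
  search P-resp P? = map′ (λ (i , Pi) → from i , Pi)
    (λ (u , Pu) → to u , P-resp (sym (strictlyInverseʳ u)) Pu) (any? (P? ∘ from))

  n≢0 : NonZero n
  n≢0 = go (to ε)
    where
    go : ∀ {n} → Fin n → NonZero n
    go fzero    = _
    go (fsuc _) = _

  abstract
    -- Two of the `n + 1` powers with exponents 0 to `n` coincide, and cancelling the smaller one
    -- leaves a trivial positive power.
    periodic : ∀ u → ∃[ j ] suc j · u ≈ ε
    periodic u with i , k , i<k , eq ← Finₚ.pigeonhole (ℕₚ.n<1+n n) (λ i → to (Fin.toℕ i · u))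
      with j , 1+i+j≡k ← ℕₚ.m≤n⇒∃[o]m+o≡n i<k = j , identityʳ-unique (Fin.toℕ i · u) _ (begin
        Fin.toℕ i · u ∙ suc j · u   ≈⟨ ×-homo-+ u (Fin.toℕ i) (suc j) ⟨
        (Fin.toℕ i + suc j) · u     ≈⟨ ×-congˡ (≡.trans (ℕₚ.+-suc _ j) 1+i+j≡k) ⟩
        Fin.toℕ k · u               ≈⟨ to-injective eq ⟨
        Fin.toℕ i · u               ∎)

  -- The cosets of ⟨u⟩ are enumerated greedily, each new representative lying outside
  -- the cosets already listed.
  abstract
    lagrange : ∀ u → n · u ≈ ε
    lagrange u with o , o·u≈ε , minimal ← least (λ j → suc j · u ≟ ε) {proj₁ (periodic u)} (proj₂ (periodic u)) = result
      where
      O : ℕ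
      O = suc o

      infix 4 _∼_ _∼?_

      _∼_ : Carrier → Carrier → Set ℓ
      g ∼ h = ∃[ i ] g ≈ i · u ∙ h

      ∼-sym : ∀ {g h} → g ∼ h → h ∼ g
      -- Since `O = 1 + o` annihilates `u`, the exponent `i * o` acts as -i.
      ∼-sym {g} {h} (i , g≈) = i * o , sym (begin
        (i * o) · u ∙ g              ≈⟨ ∙-congˡ g≈ ⟩
        (i * o) · u ∙ (i · u ∙ h)    ≈⟨ assoc _ _ _ ⟨
        ((i * o) · u ∙ i · u) ∙ h    ≈⟨ ∙-congʳ (×-homo-+ u (i * o) i) ⟨
        (i * o + i) · u ∙ h          ≈⟨ ∙-congʳ (mod-· o·u≈ε (subst (_≡ 0 [mod O ]) (factor i o) (multiple-mod i))) ⟩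
        0 · u ∙ h                    ≈⟨ identityˡ h ⟩
        h                            ∎)
        where
        factor : ∀ i o → i * (1 + o) ≡ i * o + i
        factor = solve-∀

      reduce : ∀ {g h} → g ∼ h → ∃[ i ] g ≈ Fin.toℕ {O} i · u ∙ h
      reduce {g} {h} (i , g≈) = Fin.fromℕ< (m%n<n i O) , (begin
        g                                           ≈⟨ g≈ ⟩
        i · u ∙ h                                   ≈⟨ ∙-congʳ (mod-· o·u≈ε (%-mod i O)) ⟨
        (i % O) · u ∙ h                             ≈⟨ ∙-congʳ (×-congˡ (Finₚ.toℕ-fromℕ< (m%n<n i O))) ⟨
        Fin.toℕ (Fin.fromℕ< (m%n<n i O)) · u ∙ h    ∎)

      _∼?_ : ∀ g h → Dec (g ∼ h)
      g ∼? h = map′ (λ (i , eq) → Fin.toℕ i , eq) reduce (any? (λ (i : Fin O) → g ≟ (Fin.toℕ i · u ∙ h)))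

      <-distinct : ∀ {i j} → i < j → j < O → ¬ (i · u ≈ j · u)
      <-distinct {i} {j} i<j j<O eq with k , 1+i+k≡j ← ℕₚ.m≤n⇒∃[o]m+o≡n i<j =
        minimal k<o (identityʳ-unique (i · u) _ (begin
          i · u ∙ suc k · u   ≈⟨ ×-homo-+ u i (suc k) ⟨
          (i + suc k) · u     ≈⟨ ×-congˡ (≡.trans (ℕₚ.+-suc i k) 1+i+k≡j) ⟩
          j · u               ≈⟨ eq ⟨
          i · u               ∎))
        where
        k<o : k < o
        k<o = ℕₚ.<-≤-trans (subst (k <_) 1+i+k≡j (s≤s (ℕₚ.m≤n+m k i))) (ℕₚ.<⇒≤pred j<O)

      exponent-injective : ∀ {i j : Fin O} → Fin.toℕ i · u ≈ Fin.toℕ j · u → i ≡ j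
      exponent-injective {i} {j} eq with Finₚ.<-cmp i j
      ... | tri< i<j _ _ = contradiction eq (<-distinct i<j (Finₚ.toℕ<n j))
      ... | tri≈ _ i≡j _ = i≡j
      ... | tri> _ _ j<i = contradiction (sym eq) (<-distinct j<i (Finₚ.toℕ<n i))

      Separated : ∀ {t} → (Fin t → Carrier) → Set ℓ
      Separated f = ∀ {a b} → f a ∼ f b → a ≡ b

      -- Separated cosets are disjoint and have `O` elements each, so their points inject into the
      -- group.
      size≤n : ∀ {t} {f : Fin t → Carrier} → Separated f → t * O ≤ n
      size≤n {t} {f} separated = injective⇒≤ {f = λ x → to (point (Fin.remQuot {t} O x))} λ {x} {y} eq →
        ≡.trans (≡.sym (Finₚ.combine-remQuot {t} O x))
          (≡.trans (cong (λ (a , i) → Fin.combine a i) (point-injective (to-injective eq)))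
                   (Finₚ.combine-remQuot {t} O y))
        where
        point : Fin t × Fin O → Carrier
        point (a , i) = Fin.toℕ i · u ∙ f a
        same-coset : ∀ {a b i j} → point (a , i) ≈ point (b , j) → f b ∼ f a
        same-coset {a} {b} {i} {j} eq =
          let k , fb≈ = ∼-sym {point (b , j)} {f b} (Fin.toℕ j , refl)
          in k + Fin.toℕ i , (begin
            f b                                ≈⟨ fb≈ ⟩
            k · u ∙ point (b , j)              ≈⟨ ∙-congˡ eq ⟨
            k · u ∙ (Fin.toℕ i · u ∙ f a)      ≈⟨ assoc _ _ _ ⟨
            (k · u ∙ Fin.toℕ i · u) ∙ f a      ≈⟨ ∙-congʳ (×-homo-+ u k (Fin.toℕ i)) ⟨
            (k + Fin.toℕ i) · u ∙ f a          ∎)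
        point-injective′ : ∀ {a b i j} → b ≡ a → point (a , i) ≈ point (b , j) → (a , i) ≡ (b , j)
        point-injective′ {a} ≡.refl eq = cong (a ,_) (exponent-injective (∙-cancelʳ (f a) _ _ eq))
        point-injective : ∀ {x y} → point x ≈ point y → x ≡ y
        point-injective {a , i} {b , j} eq =
          point-injective′ {a} {b} {i} {j} (separated (same-coset {a} {b} {i} {j} eq)) eq

      Complete : ∀ {t} → (Fin t → Carrier) → Set (c ⊔ ℓ)
      Complete f = ∀ g → ∃[ a ] g ∼ f a

      -- With no fuel left the bound would give more than `n` representatives, against `size≤n`; so
      -- the recursion stops at a complete list.
      enumerate : ∀ fuel {t} (f : Fin t → Carrier) → Separated f → n < t + fuel →
                  ∃[ t ] ∃[ f ] (Separated {t} f × Complete f)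
      enumerate zero {t} f separated n<t = contradiction (ℕₚ.<-≤-trans n<t
        (subst (_≤ t * O) (≡.sym (ℕₚ.+-identityʳ t)) (ℕₚ.m≤m*n t O))) (ℕₚ.≤⇒≯ (size≤n separated))
      enumerate (suc fuel) {t} f separated n<
        with search {P = λ g → ∀ a → ¬ (g ∼ f a)}
               (λ g≈h new a (i , h≈) → new a (i , trans g≈h h≈))
               (λ g → all? (λ a → ¬? (g ∼? f a)))
      ... | yes (g , new) = enumerate fuel f⁺ separated⁺ (subst (n <_) (ℕₚ.+-suc t fuel) n<)
        where
        f⁺ : Fin (suc t) → Carrier
        f⁺ fzero    = g
        f⁺ (fsuc a) = f a
        separated⁺ : Separated f⁺
        separated⁺ {fzero}  {fzero}  _ = ≡.refl
        separated⁺ {fzero}  {fsuc b} s = contradiction s (new b)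
        separated⁺ {fsuc a} {fzero}  s = contradiction (∼-sym s) (new a)
        separated⁺ {fsuc a} {fsuc b} s = cong fsuc (separated s)
      ... | no ¬new = t , f , separated , complete
        where
        complete : Complete f
        complete g with any? (λ a → g ∼? f a)
        ... | yes found = found
        ... | no none   = contradiction (g , λ a s → none (a , s)) ¬new

      result : n · u ≈ ε
      result with t , f , separated , complete ← enumerate (suc n) {0} (λ ()) (λ { {()} }) ℕₚ.≤-refl =
        -- Separation gives `t * O ≤ n` and completeness the converse, so `n` is a multiple of the
        -- order `O` of `u`.
        trans (×-congˡ (ℕₚ.≤-antisym n≤t*O (size≤n separated)))
          (trans (sym (×-assocˡ u t O)) (trans (×-congʳ t o·u≈ε) (·-ε t)))
        where
        index : Fin n → Fin (t * O)
        index x = let a , s = complete (from x) in Fin.combine a (proj₁ (reduce s))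
        index-injective : ∀ {x y} → index x ≡ index y → x ≡ y
        index-injective {x} {y} eq = ≡.trans (≡.sym (strictlyInverseˡ x))
          (≡.trans (to-cong from≈) (strictlyInverseˡ y))
          where
          ax : ∃[ a ] from x ∼ f a
          ax = complete (from x)
          ay : ∃[ a ] from y ∼ f a
          ay = complete (from y)
          from≈ : from x ≈ from y
          from≈ = let a≡b , i≡j = Finₚ.combine-injective _ _ _ _ eq in begin
            from x                                                    ≈⟨ proj₂ (reduce (proj₂ ax)) ⟩
            Fin.toℕ (proj₁ (reduce (proj₂ ax))) · u ∙ f (proj₁ ax)    ≡⟨ ≡.cong₂ (λ i a → Fin.toℕ i · u ∙ f a) i≡j a≡b ⟩
            Fin.toℕ (proj₁ (reduce (proj₂ ay))) · u ∙ f (proj₁ ay)    ≈⟨ proj₂ (reduce (proj₂ ay)) ⟨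
            from y                                                    ∎
        n≤t*O : n ≤ t * O
        n≤t*O = injective⇒≤ index-injective

  inverse-power : ∀ u → (n ∸ 1) · u ≈ u ⁻¹
  inverse-power u = inverseʳ-unique u _ (trans (×-congˡ (ℕₚ.suc-pred n {{n≢0}})) (lagrange u))

  -- In a finite group the inverse is a power, so closure of `R` under products handles the case
  -- `inv`.
  generated⊆ : ∀ {S : Pred Carrier ℓ} (R : Pred Carrier p) → (∀ {u v} → u ≈ v → R u → R v) →
               R ε → (∀ {u v} → R u → R v → R (u ∙ v)) → (∀ {u} → S u → R u) →
               ∀ {u} → u ∈ Generated G S → R u
  generated⊆ R R-resp R-ε R-∙ S⊆R = go
    where
    R-· : ∀ m {u} → R u → R (m · u)
    R-· zero    Ru = R-ε
    R-· (suc m) Ru = R-∙ Ru (R-· m Ru)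
    go : ∀ {u} → u ∈ Generated G _ → R u
    go (gen u∈S)    = S⊆R u∈S
    go (resp eq u∈) = R-resp eq (go u∈)
    go one          = R-ε
    go (mul u∈ v∈)  = R-∙ (go u∈) (go v∈)
    go (inv u∈)     = R-resp (inverse-power _) (R-· (n ∸ 1) (go u∈))

  abstract
    ∈⟨⟩⇒power : ∀ {u w} → u ∈ ⟨ G ⟩ w → ∃[ s ] u ≈ s · w
    ∈⟨⟩⇒power {w = w} = generated⊆ (λ u → ∃[ s ] u ≈ s · w)
      (λ u≈v (s , eq) → s , trans (sym u≈v) eq) (0 , refl)
      (λ (s , u≈) (t , v≈) → s + t , trans (∙-cong u≈ v≈) (sym (×-homo-+ w s t)))
      (λ u≈w → 1 , trans u≈w (sym (×-homo-1 w)))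

  _∈⟨_⟩? : ∀ u w → Dec (u ∈ ⟨ G ⟩ w)
  u ∈⟨ w ⟩? = map′ (λ (i , eq) → resp (sym eq) (power∈ (Fin.toℕ i) w)) reduce
    (any? (λ (i : Fin n) → u ≟ (Fin.toℕ i · w)))
    where
    instance _ = n≢0
    reduce : u ∈ ⟨ G ⟩ w → ∃[ i ] u ≈ Fin.toℕ {n} i · w
    reduce u∈ = let s , u≈ = ∈⟨⟩⇒power u∈ in Fin.fromℕ< (m%n<n s n) , (begin
      u                                       ≈⟨ u≈ ⟩
      s · w                                   ≈⟨ mod-· (lagrange w) (%-mod s n) ⟨
      (s % n) · w                             ≈⟨ ×-congˡ (Finₚ.toℕ-fromℕ< (m%n<n s n)) ⟨
      Fin.toℕ (Fin.fromℕ< (m%n<n s n)) · w    ∎)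

-- Odd p-groups with a unique subgroup of order p

prime∤⇒coprime : ∀ {p l} → Prime p → ¬ (p ∣ l) → Coprime l p
prime∤⇒coprime p-prime p∤l {d} (d∣l , d∣p) with prime⇒irreducible p-prime d∣p
... | inj₁ d≡1    = d≡1
... | inj₂ ≡.refl = contradiction d∣l p∤l

coprime-1+multiple : ∀ p k → Coprime (1 + p * k) p
coprime-1+multiple p k {d} (d∣1+pk , d∣p) =
  Div.∣1⇒≡1 (Div.∣m+n∣m⇒∣n (subst (d ∣_) (ℕₚ.+-comm 1 (p * k)) d∣1+pk) (Div.∣m⇒∣m*n k d∣p))

abstract
  odd-form : ∀ {p} → ¬ (2 ∣ p) → ∃[ q ] p ≡ 1 + 2 * q
  odd-form {p} 2∤p with p % 2 in eq | m≡m%n+[m/n]*n p 2 | m%n<n p 2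
  ... | 0           | p≡ | _                = contradiction (divides (p / 2) p≡) 2∤p
  ... | 1           | p≡ | _                = p / 2 , ≡.trans p≡ (cong suc (ℕₚ.*-comm (p / 2) 2))
  ... | suc (suc _) | _  | s≤s (s≤s ())

-- The sum 1 + s + ... + s^(j-1) in Horner form: the exponent that `g` accumulates in the `j`-th
-- power of `g ∙ h` when `h` conjugates `g` to `s · g`.
geometric : ℕ → ℕ → ℕ
geometric s zero    = 0
geometric s (suc j) = 1 + s * geometric s j

-- The binomial coefficient `j` choose 2.
triangular : ℕ → ℕ
triangular zero    = 0
triangular (suc j) = j + triangular j

2*triangular : ∀ j → 2 * triangular (suc j) ≡ suc j * j
2*triangular zero    = ≡.refl
2*triangular (suc j) = begin
  2 * (1 + j + triangular (suc j))       ≡⟨ ℕₚ.*-distribˡ-+ 2 (1 + j) (triangular (suc j)) ⟩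
  2 * (1 + j) + 2 * triangular (suc j)   ≡⟨ cong (λ t → 2 * (1 + j) + t) (2*triangular j) ⟩
  2 * (1 + j) + (1 + j) * j              ≡⟨ regroup j ⟩
  (2 + j) * (1 + j)                      ∎
  where
  open ≡.≡-Reasoning
  regroup : ∀ j → 2 * (1 + j) + (1 + j) * j ≡ (2 + j) * (1 + j)
  regroup = solve-∀

triangular-odd : ∀ q → triangular (1 + 2 * q) ≡ (1 + 2 * q) * q
triangular-odd q = ℕₚ.*-cancelˡ-≡ _ _ 2 (≡.trans (2*triangular (2 * q)) (regroup q))
  where
  regroup : ∀ q → (1 + 2 * q) * (2 * q) ≡ 2 * ((1 + 2 * q) * q)
  regroup = solve-∀

-- Modulo p² the power (1 + pu)^i is 1 + ipu; summing over i < j produces the triangular number, and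
-- `R` collects the rest.
geometric-expansion : ∀ p u j →
  ∃[ R ] geometric (1 + p * u) j ≡ j + p * u * triangular j + p * p * R
geometric-expansion p u zero    = 0 , regroup p u
  where
  regroup : ∀ p u → 0 ≡ 0 + p * u * 0 + p * p * 0
  regroup = solve-∀
geometric-expansion p u (suc j) = let R , eq = geometric-expansion p u j; T = triangular j in
  R + u * u * T + p * u * R ,
  ≡.trans (cong (λ t → 1 + (1 + p * u) * t) eq) (regroup p u j T R)
  where
  regroup : ∀ p u j T R → 1 + (1 + p * u) * (j + p * u * T + p * p * R) ≡
            1 + j + p * u * (j + T) + p * p * (R + u * u * T + p * u * R)
  regroup = solve-∀

-- For p = 2 this fails: 1 + (1 + 2 u) is divisible by 4 when u is odd.
abstract
  geometric-odd : ∀ {p} u → ¬ (2 ∣ p) → ∃[ k ] geometric (1 + p * u) p ≡ p * (1 + p * k)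
  geometric-odd {p} u 2∤p with q , ≡.refl ← odd-form 2∤p =
    let R , eq = geometric-expansion p u p in
    u * q + R , ≡.trans eq (≡.trans (cong (λ t → p + p * u * t + p * p * R) (triangular-odd q))
                                    (regroup p u q R))
    where
    regroup : ∀ p u q R → p + p * u * (p * q) + p * p * R ≡ p * (1 + p * (u * q + R))
    regroup = solve-∀

module PGroup (G : Group c ℓ) (p a : ℕ) (p-prime : Prime p) (|G| : HasOrder G (p ^ a)) where
  open Group G
  open Powers G
  open Finite G (p ^ a) |G| public
  open import Relation.Binary.Reasoning.Setoid setoid
  private instance
    p≢0 : NonZero p
    p≢0 = prime⇒nonZero p-prime
    pᵃ≢0 : NonZero (p ^ a)
    pᵃ≢0 = n≢0

  HasPrimeOrder : Pred Carrier _
  HasPrimeOrder u = u ≉ ε × p · u ≈ ε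

  p∤⇒root : ∀ {l} u → ¬ (p ∣ l) → ∃[ l′ ] l′ · (l · u) ≈ u
  p∤⇒root u p∤l = coprime-root (lagrange u)
    (Coprimality.sym (coprime-^ a (Coprimality.sym (prime∤⇒coprime p-prime p∤l))))

  -- An exponent prime to `p` can be inverted on the powers of `w`, so it cannot kill a nontrivial
  -- `w`.
  annihilator-divisible : ∀ {w} m → w ≉ ε → m · w ≈ ε → p ∣ m
  annihilator-divisible {w} m w≉ε m·w≈ε with p Div.∣? m
  ... | yes p∣m = p∣m
  ... | no p∤m  = let l , eq = p∤⇒root w p∤m in
    contradiction (trans (sym eq) (trans (×-congʳ l m·w≈ε) (·-ε l))) w≉ε

  -- The order of `w` is a power of `p` exceeding `p ^ b`. Each step strips one factor `p` from `m`
  -- and passes from `w` to `p · w`.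
  p-divides-annihilator : ∀ b {w} m → p ^ b · w ≉ ε → m · w ≈ ε → p ^ suc b ∣ m
  p-divides-annihilator zero    {w} m 1·w≉ε m·w≈ε =
    subst (_∣ m) (≡.sym (ℕₚ.*-identityʳ p)) (annihilator-divisible m (λ w≈ε → 1·w≉ε (trans (×-homo-1 w) w≈ε)) m·w≈ε)
  p-divides-annihilator (suc b) {w} m pᵇ⁺¹·w≉ε m·w≈ε
    with divides m′ ≡.refl ← annihilator-divisible m
      (λ w≈ε → pᵇ⁺¹·w≉ε (trans (×-congʳ (p ^ suc b) w≈ε) (·-ε (p ^ suc b)))) m·w≈ε =
    subst (_∣ m′ * p) (ℕₚ.*-comm (p ^ suc b) p) (Div.*-monoˡ-∣ p
      (p-divides-annihilator b {p · w} m′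
        (λ eq → pᵇ⁺¹·w≉ε (trans (×-congˡ (ℕₚ.*-comm p (p ^ b))) (trans (sym (×-assocˡ w (p ^ b) p)) eq)))
        (trans (×-assocˡ w m′ p) m·w≈ε)))

  abstract
    -- The iterated `p`-th powers of `u` reach ε, hence enter `S`; the witness is the one just
    -- before the first entry. With `S` trivial this finds an element of order `p`; with `S` a
    -- cyclic subgroup it builds an `Extension`.
    last-power : {S : Pred Carrier v} → (∀ {x y} → x ≈ y → S x → S y) → Decidable S → S ε →
                 ∀ {u} → ¬ S u → ∃[ b ] (¬ S (p ^ b · u) × S (p · (p ^ b · u)))
    last-power {S = S} S-resp S? Sε {u} ¬Su
      with least (λ j → S? (p ^ j · u)) {a} (S-resp (sym (lagrange u)) Sε)
    ... | zero  , S1u , _    = contradiction (S-resp (×-homo-1 u) S1u) ¬Su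
    ... | suc b , Su  , none = b , none ℕₚ.≤-refl , S-resp (sym (×-assocˡ u p (p ^ b))) Su

  socle : ∀ {u} → u ≉ ε → ∃[ b ] HasPrimeOrder (p ^ b · u)
  socle = last-power {S = _≈ ε} (λ x≈y x≈ε → trans (sym x≈y) x≈ε) (_≟ ε) refl

  prime-order-generates : ∀ {u w} → HasPrimeOrder w → u ≉ ε → u ∈ ⟨ G ⟩ w → w ∈ ⟨ G ⟩ u
  prime-order-generates {u} {w} (_ , p·w≈ε) u≉ε u∈ with s , u≈ ← ∈⟨⟩⇒power u∈ | p Div.∣? s
  ... | yes (divides q ≡.refl) = contradiction
    (trans u≈ (trans (sym (×-assocˡ w q p)) (trans (×-congʳ q p·w≈ε) (·-ε q)))) u≉ε
  ... | no p∤s = let l , eq = p∤⇒root w p∤s in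
    resp (trans (×-congʳ l u≈) eq) (power∈ l u)

  -- A cyclic p-group has a single subgroup of order `p`: both elements are powers of the multiple
  -- `p ^ b · w` given by `socle`.
  cyclic-prime-order : ∀ {u v w} → HasPrimeOrder u → HasPrimeOrder v →
                       u ∈ ⟨ G ⟩ w → v ∈ ⟨ G ⟩ w → u ∈ ⟨ G ⟩ v
  cyclic-prime-order {u} {v} {w} prime-u prime-v u∈ v∈ =
    ⟨⟩-trans (∈socle prime-u u∈) (prime-order-generates (proj₂ b) (proj₁ prime-v) (∈socle prime-v v∈))
    where
    w≉ε : w ≉ ε
    w≉ε w≈ε = let s , u≈ = ∈⟨⟩⇒power u∈ in
      proj₁ prime-u (trans u≈ (trans (×-congʳ s w≈ε) (·-ε s)))
    b = socle w≉ε
    ∈socle : ∀ {u} → HasPrimeOrder u → u ∈ ⟨ G ⟩ w → u ∈ ⟨ G ⟩ (p ^ proj₁ b · w)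
    -- With `u ≈ s · w`, the exponent `p * s` annihilates `w`, so `p ^ suc b` divides it and `p ^ b`
    -- divides `s`.
    ∈socle {u} (_ , p·u≈ε) u∈ with s , u≈ ← ∈⟨⟩⇒power u∈
      with divides q ≡.refl ← Div.*-cancelˡ-∣ {p ^ proj₁ b} {s} p (p-divides-annihilator (proj₁ b) {w} (p * s)
             (proj₁ (proj₂ b)) (trans (sym (×-assocˡ w p s)) (trans (×-congʳ p (sym u≈)) p·u≈ε))) =
      resp (trans (×-assocˡ w q (p ^ proj₁ b)) (sym u≈)) (power∈ q (p ^ proj₁ b · w))

  Commutes : Carrier → Carrier → Set _
  Commutes u h = u ∙ h ≈ h ∙ u

  commutes-· : ∀ {u h} n → Commutes u h → Commutes (n · u) h
  commutes-· {u} {h} zero    uh = trans (identityˡ h) (sym (identityʳ h))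
  commutes-· {u} {h} (suc n) uh = begin
    (u ∙ n · u) ∙ h   ≈⟨ assoc u (n · u) h ⟩
    u ∙ (n · u ∙ h)   ≈⟨ ∙-congˡ (commutes-· n uh) ⟩
    u ∙ (h ∙ n · u)   ≈⟨ assoc u h (n · u) ⟨
    (u ∙ h) ∙ n · u   ≈⟨ ∙-congʳ uh ⟩
    (h ∙ u) ∙ n · u   ≈⟨ assoc h u (n · u) ⟩
    h ∙ (u ∙ n · u)   ∎

  commutator : Carrier → Carrier → Carrier
  commutator g h = ((g ∙ h) ∙ g ⁻¹) ∙ h ⁻¹

  abstract
    -- Either `g` commutes with everything, or a nontrivial commutator of it lies one step lower in
    -- the upper central series.
    nontrivial-central : ∀ i {g} → g ∈ UpperCentral G i → g ≉ ε → ∃[ z ] (z ≉ ε × ∀ h → Commutes z h)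
    nontrivial-central zero        (base g≈ε)   g≉ε = contradiction g≈ε g≉ε
    nontrivial-central (suc i) {g} (step lower) g≉ε
      with search {P = λ h → commutator g h ≉ ε}
             (λ h≈k ≉ε ≈ε → ≉ε (trans (∙-cong (∙-congʳ (∙-congˡ h≈k)) (⁻¹-cong h≈k)) ≈ε))
             (λ h → ¬? (commutator g h ≟ ε))
    ... | yes (h , ≉ε) = nontrivial-central i (lower h) ≉ε
    ... | no none      = g , g≉ε , λ h → begin
      g ∙ h                   ≈⟨ //-rightDividesˡ g (g ∙ h) ⟨
      ((g ∙ h) ∙ g ⁻¹) ∙ g    ≈⟨ ∙-congʳ (x∙y⁻¹≈ε⇒x≈y _ h (decidable-stable (commutator g h ≟ ε) (λ ≉ε → none (h , ≉ε)))) ⟩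
      h ∙ g                   ∎

  conjugate-∈ : ∀ {h g u} → conjugate h g ∈ ⟨ G ⟩ g → u ∈ ⟨ G ⟩ g → conjugate h u ∈ ⟨ G ⟩ g
  conjugate-∈ {h} {g} {u} hg∈ u∈ = let s , u≈ = ∈⟨⟩⇒power u∈ in
    resp (trans (sym (conjugate-· h g s)) (∙-congʳ (∙-congˡ (sym u≈)))) (⟨⟩-trans (power∈ s _) hg∈)

  power-conjugate-∈ : ∀ {h g} m → conjugate h g ∈ ⟨ G ⟩ g → conjugate (m · h) g ∈ ⟨ G ⟩ g
  power-conjugate-∈ {h} {g} zero    hg∈ = resp (sym (trans (∙-cong (identityˡ g) ε⁻¹≈ε) (identityʳ g))) (gen refl)
  power-conjugate-∈ {h} {g} (suc m) hg∈ =
    resp (sym (conjugate-∙ h (m · h) g)) (conjugate-∈ {h} hg∈ (power-conjugate-∈ m hg∈))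

  abstract
    -- If the commutator of `h` and `g` lies in ⟨ g ⟩, then so does the conjugate of `g` by `h`.
    -- Otherwise the commutator is itself outside ⟨ g ⟩ and one step lower in the upper central
    -- series, so it replaces `h`.
    normalizer-grows : ∀ i {g h} → h ∈ UpperCentral G i → ¬ (h ∈ ⟨ G ⟩ g) →
                       ∃[ k ] (¬ (k ∈ ⟨ G ⟩ g) × conjugate k g ∈ ⟨ G ⟩ g)
    normalizer-grows zero            (base h≈ε)   h∉ = contradiction (resp (sym h≈ε) one) h∉
    normalizer-grows (suc i) {g} {h} (step lower) h∉ with commutator h g ∈⟨ g ⟩?
    ... | yes c∈ = h , h∉ , resp (//-rightDividesˡ g _) (mul c∈ (gen refl))
    ... | no c∉  = normalizer-grows i (lower g) c∉

  record Extension (g : Carrier) : Set (c ⊔ ℓ) where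
    field
      h   : Carrier
      h∉  : ¬ (h ∈ ⟨ G ⟩ g)
      s l : ℕ
      conjugate-h : conjugate h g ≈ s · g
      power-h     : p · h ≈ l · g

  abstract
    -- Among the iterated `p`-th powers of a normalising element outside ⟨ g ⟩, the last one outside
    -- is taken; being a power, it still normalises.
    extension : IsNilpotent G → ∀ {g h} → ¬ (h ∈ ⟨ G ⟩ g) → Extension g
    extension (i , upper) {g} {h} h∉
      with k , k∉ , kg∈ ← normalizer-grows i (upper h) h∉
      with b , ∉ , ∈ ← last-power resp (_∈⟨ g ⟩?) one k∉ = record
        { h = p ^ b · k ; h∉ = ∉
        ; s = proj₁ conjugate-power ; l = proj₁ (∈⟨⟩⇒power ∈)
        ; conjugate-h = proj₂ conjugate-power ; power-h = proj₂ (∈⟨⟩⇒power ∈)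
        }
        where
        conjugate-power : ∃[ s ] conjugate (p ^ b · k) g ≈ s · g
        conjugate-power = ∈⟨⟩⇒power (power-conjugate-∈ (p ^ b) kg∈)

  module _ {g h s} (hgh⁻¹≈ : conjugate h g ≈ s · g) where
    -- Moving `h` past a power of `g` multiplies the exponent by `s`, so the copies of `g`
    -- accumulate as a geometric sum.
    power-of-product : ∀ m j → j · (m · g ∙ h) ≈ (m * geometric s j) · g ∙ j · h
    power-of-product m zero    = sym (trans (∙-congʳ (×-congˡ (ℕₚ.*-zeroʳ m))) (identityˡ ε))
    power-of-product m (suc j) = begin
      (m · g ∙ h) ∙ j · (m · g ∙ h)               ≈⟨ ∙-congˡ (power-of-product m j) ⟩
      (m · g ∙ h) ∙ ((m * S) · g ∙ j · h)         ≈⟨ assoc _ _ _ ⟨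
      ((m · g ∙ h) ∙ (m * S) · g) ∙ j · h         ≈⟨ ∙-congʳ (assoc _ _ _) ⟩
      (m · g ∙ (h ∙ (m * S) · g)) ∙ j · h         ≈⟨ ∙-congʳ (∙-congˡ (move-past hgh⁻¹≈ (m * S))) ⟩
      (m · g ∙ ((m * S * s) · g ∙ h)) ∙ j · h     ≈⟨ ∙-congʳ (assoc _ _ _) ⟨
      ((m · g ∙ (m * S * s) · g) ∙ h) ∙ j · h     ≈⟨ ∙-congʳ (∙-congʳ (×-homo-+ g m (m * S * s))) ⟨
      ((m + m * S * s) · g ∙ h) ∙ j · h           ≈⟨ assoc _ _ _ ⟩
      (m + m * S * s) · g ∙ (h ∙ j · h)           ≈⟨ ∙-congʳ (×-congˡ (regroup m S s)) ⟩
      (m * (1 + s * S)) · g ∙ (h ∙ j · h)         ∎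
      where
      S = geometric s j
      regroup : ∀ m S s → m + m * S * s ≡ m * (1 + s * S)
      regroup = solve-∀

  module _ (p-odd : ¬ (2 ∣ p)) (nilpotent : IsNilpotent G)
           (unique : ∀ {u v} → HasPrimeOrder u → HasPrimeOrder v → u ∈ ⟨ G ⟩ v) where

    -- The centre of a nontrivial nilpotent group is nontrivial and so contains an element of order
    -- `p`; by uniqueness `u` is a power of it.
    prime-order-central : ∀ {u} → HasPrimeOrder u → ∀ h → Commutes u h
    prime-order-central {u} prime-u h
      with z , z≉ε , central ← nontrivial-central (proj₁ nilpotent) (proj₂ nilpotent u) (proj₁ prime-u)
      with b , prime-z ← socle z≉ε
      with s , u≈ ← ∈⟨⟩⇒power (unique prime-u prime-z) =
      trans (∙-congʳ u≈) (trans (commutes-· s (commutes-· (p ^ b) (central h))) (∙-congˡ (sym u≈)))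

    -- Conjugation by `h` raises the powers of `g` to the power `s` but fixes the one of order `p`,
    -- which is central; so `p` divides s - 1.
    conjugation-exponent : ∀ {g h s} → g ≉ ε → conjugate h g ≈ s · g → ∃[ u ] s ≡ 1 + p * u
    conjugation-exponent {g} {h} {s} g≉ε hgh⁻¹≈ with b , prime-a@(a≉ε , _) ← socle g≉ε = exponent s s·a≈a
      where
      a₁ = p ^ b · g
      s·a≈a : s · a₁ ≈ a₁
      s·a≈a = begin
        s · a₁                       ≈⟨ ·-comm s (p ^ b) g ⟩
        p ^ b · (s · g)              ≈⟨ ×-congʳ (p ^ b) hgh⁻¹≈ ⟨
        p ^ b · conjugate h g        ≈⟨ conjugate-· h g (p ^ b) ⟨
        (h ∙ a₁) ∙ h ⁻¹              ≈⟨ ∙-congʳ (prime-order-central prime-a h) ⟨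
        (a₁ ∙ h) ∙ h ⁻¹              ≈⟨ //-rightDividesʳ h a₁ ⟩
        a₁                           ∎
      exponent : ∀ s → s · a₁ ≈ a₁ → ∃[ u ] s ≡ 1 + p * u
      exponent zero    ε≈a = contradiction (sym ε≈a) a≉ε
      exponent (suc s) eq with annihilator-divisible s a≉ε (identityʳ-unique a₁ (s · a₁) eq)
      ... | divides u ≡.refl = u , cong suc (ℕₚ.*-comm u p)

    -- If p ∣ l, then some m · g ∙ h has order p, so it lies in ⟨ g ⟩ by uniqueness.
    extension-exponent : ∀ {g} → g ≉ ε → (E : Extension g) → ¬ (p ∣ Extension.l E)
    extension-exponent {g} g≉ε E (divides t l≡t*p) = h∉ (resp (\\-leftDividesʳ (m · g) h) (mul (inv (power∈ m g)) y∈))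
      where
      open Extension E
      s≡1+pu = conjugation-exponent g≉ε conjugate-h
      S = geometric-odd {p} (proj₁ s≡1+pu) p-odd
      v₁ = 1 + p * proj₁ S
      v₁⁻¹ : ∃[ v′ ] v′ * v₁ ≡ 1 [mod p ^ a ]
      v₁⁻¹ = mod-inverse (Coprimality.sym (coprime-^ a (Coprimality.sym (coprime-1+multiple p (proj₁ S)))))
      v′ = proj₁ v₁⁻¹
      q = p ^ a ∸ 1
      -- Modulo `p ^ a`, `q` is -1 and `v′` inverts `v₁`. As the geometric sum is `p * v₁` and `l`
      -- is `t * p`, this choice turns `m * geometric s p + l` into -tp + tp.
      m = v′ * t * q
      y = m · g ∙ h
      exponent≡0 : m * geometric s p + l ≡ 0 [mod p ^ a ]
      exponent≡0 = subst (_≡ 0 [mod p ^ a ])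
        (≡.sym (≡.cong₂ (λ S l → m * S + l) (≡.trans (cong (λ s → geometric s p) (proj₂ s≡1+pu)) (proj₂ S)) l≡t*p))
        (mod-trans (subst (_≡ q * p * t * 1 + t * p [mod p ^ a ]) (regroup q p t v′ v₁)
                     (mod-+ (mod-*ˡ (q * p * t) (proj₂ v₁⁻¹)) mod-refl))
          (subst (_≡ 0 [mod p ^ a ]) (≡.sym (≡.trans (regroup′ q p t)
                   (cong (p * t *_) (ℕₚ.suc-pred (p ^ a))))) (multiple-mod (p * t))))
        where
        regroup : ∀ q p t v′ v → q * p * t * (v′ * v) + t * p ≡ v′ * t * q * (p * v) + t * p
        regroup = solve-∀
        regroup′ : ∀ q p t → q * p * t * 1 + t * p ≡ p * t * (1 + q)
        regroup′ = solve-∀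
      p·y≈ε : p · y ≈ ε
      p·y≈ε = begin
        p · y                                ≈⟨ power-of-product conjugate-h m p ⟩
        (m * geometric s p) · g ∙ p · h      ≈⟨ ∙-congˡ power-h ⟩
        (m * geometric s p) · g ∙ l · g      ≈⟨ ×-homo-+ g (m * geometric s p) l ⟨
        (m * geometric s p + l) · g          ≈⟨ mod-· (lagrange g) exponent≡0 ⟩
        ε                                    ∎
      y≉ε : y ≉ ε
      y≉ε y≈ε = h∉ (resp (sym (inverseʳ-unique _ h y≈ε)) (inv (power∈ m g)))
      y∈ : y ∈ ⟨ G ⟩ g
      y∈ = let b , prime-g = socle g≉ε in ⟨⟩-trans (unique (y≉ε , p·y≈ε) prime-g) (power∈ (p ^ b) g)

    -- The invariant is that the order of `g` exceeds `p ^ b`. While ⟨ g ⟩ is not everything, an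
    -- extension raises `b` by one, and `b` cannot reach `a` because `p ^ a` annihilates the group.
    extend : ∀ fuel b g → b + fuel ≡ a → p ^ b · g ≉ ε → IsCyclic G
    extend fuel b g b+fuel≡a pᵇ·g≉ε
      with search {P = λ h → ¬ (h ∈ ⟨ G ⟩ g)} (λ h≈k h∉ k∈ → h∉ (resp (sym h≈k) k∈)) (λ h → ¬? (h ∈⟨ g ⟩?))
    extend fuel b g b+fuel≡a pᵇ·g≉ε | no none = g , λ h → decidable-stable (h ∈⟨ g ⟩?) (λ h∉ → none (h , h∉))
    extend zero b g b≡a pᵇ·g≉ε | yes _ = contradiction
      (trans (×-congˡ (cong (p ^_) (≡.trans (≡.sym (ℕₚ.+-identityʳ b)) b≡a))) (lagrange g)) pᵇ·g≉ε
    extend (suc fuel) b g b+fuel≡a pᵇ·g≉ε | yes (k , k∉) =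
      extend fuel (suc b) h (≡.trans (≡.sym (ℕₚ.+-suc b fuel)) b+fuel≡a) pᵇ⁺¹·h≉ε
      where
      open Extension (extension nilpotent k∉)
      p∤l : ¬ (p ∣ l)
      p∤l = extension-exponent (λ g≈ε → pᵇ·g≉ε (trans (×-congʳ (p ^ b) g≈ε) (·-ε (p ^ b)))) (extension nilpotent k∉)
      pᵇ⁺¹·h≉ε : p ^ suc b · h ≉ ε
      -- `p · h` is `l · g` with `l` prime to `p`, so it has the same order as `g`.
      pᵇ⁺¹·h≉ε eq = let l′ , root = p∤⇒root (p ^ b · g) p∤l in pᵇ·g≉ε (begin
        p ^ b · g                 ≈⟨ root ⟨
        l′ · (l · (p ^ b · g))    ≈⟨ ×-congʳ l′ (·-comm l (p ^ b) g) ⟩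
        l′ · (p ^ b · (l · g))    ≈⟨ ×-congʳ l′ (×-congʳ (p ^ b) power-h) ⟨
        l′ · (p ^ b · (p · h))    ≈⟨ ×-congʳ l′ (·-comm (p ^ b) p h) ⟩
        l′ · (p · (p ^ b · h))    ≈⟨ ×-congʳ l′ (×-assocˡ h p (p ^ b)) ⟩
        l′ · (p ^ suc b · h)      ≈⟨ ×-congʳ l′ eq ⟩
        l′ · ε                    ≈⟨ ·-ε l′ ⟩
        ε                         ∎)

    unique-prime-order⇒cyclic : IsCyclic G
    unique-prime-order⇒cyclic with search {P = _≉ ε} (λ u≈v u≉ε v≈ε → u≉ε (trans u≈v v≈ε)) (λ u → ¬? (u ≟ ε))
    ... | yes (g , g≉ε) = extend a 0 g ≡.refl (λ eq → g≉ε (trans (sym (×-homo-1 g)) eq))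
    ... | no none = ε , λ h → resp (sym (decidable-stable (h ≟ ε) (λ h≉ε → none (h , h≉ε)))) one

-- Classes in a Sylow subgroup

-- The share of one direct factor in a `System`. Unlike in a `CliquePartition`, members of a class
-- need only be joined to its representative: two elements of a p-group over the same subgroup of
-- order p need not lie in a common cyclic subgroup.
record Coordinate (G : Group c ℓ) (r : ℕ) : Set (c ⊔ ℓ) where
  open Group G
  field
    _≟_            : ∀ u v → Dec (u ≈ v)
    2≤r            : 2 ≤ r
    class          : Carrier → Maybe (Fin r)
    class-cong     : ∀ {u v} → u ≈ v → class u ≡ class v
    rep            : Fin r → Carrier
    class-rep      : ∀ i → class (rep i) ≡ just i
    joined-class   : ∀ {u v a b} → Joined G u v → class u ≡ just a → class v ≡ just b → a ≡ b
    joined-rep     : ∀ {u i} → class u ≡ just i → Joined G u (rep i)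
    trivial-joined : ∀ {u} → class u ≡ nothing → ∀ v → Joined G u v

module PrimeSubgroups (G : Group c ℓ) (p a : ℕ) (p-prime : Prime p) (|G| : HasOrder G (p ^ a)) where
  open Group G
  open Powers G
  open PGroup G p a p-prime |G|
  open import Relation.Binary.Reasoning.Setoid setoid
  private
    module 𝓗 = Setoid (subgroupsOfOrder G p)
    instance
      p≢0 : NonZero p
      p≢0 = prime⇒nonZero p-prime

  exponents-mod : ∀ {u} → HasPrimeOrder u → ∀ {s t} → s · u ≈ t · u → s % p ≡ t % p
  exponents-mod {u} (u≉ε , _) {s} {t} eq =
    [ (λ s≤t → ordered s≤t eq) , (λ t≤s → ≡.sym (ordered t≤s (sym eq))) ]′ (ℕₚ.≤-total s t)
    where
    ordered : ∀ {s t} → s ≤ t → s · u ≈ t · u → s % p ≡ t % p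
    ordered {s} s≤t eq with k , ≡.refl ← ℕₚ.m≤n⇒∃[o]m+o≡n s≤t
      with divides q ≡.refl ← annihilator-divisible k u≉ε
             (identityʳ-unique (s · u) _ (trans (sym (×-homo-+ u s k)) (sym eq))) =
      ≡.sym ([m+kn]%n≡m%n s q p)

  prime-order-subgroup : ∀ {u} → HasPrimeOrder u → 𝓗.Carrier
  prime-order-subgroup {u} prime-u@(_ , p·u≈ε) = ⟨ G ⟩ u ,
    record { ∈-resp-≈ = resp ; ε-closed = one ; ∙-closed = mul ; ⁻¹-closed = inv } ,
    record
      { to        = λ (v , v∈) → index v∈
      ; from      = λ i → Fin.toℕ i · u , power∈ (Fin.toℕ i) u
      ; to-cong   = λ {(v , v∈)} {(w , w∈)} v≈w → index-cong v∈ w∈ v≈w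
      ; from-cong = λ { ≡.refl → refl }
      ; inverse   = (λ {i} {(v , v∈)} v≈i → Finₚ.toℕ-injective (≡.trans (toℕ-index v∈)
                      (≡.trans (exponents-mod prime-u {t = Fin.toℕ i} (trans (sym (power v∈)) v≈i))
                               (m<n⇒m%n≡m (Finₚ.toℕ<n i)))))
                  , (λ { {v , v∈} ≡.refl → trans (×-congˡ (toℕ-index v∈))
                      (trans (mod-· p·u≈ε (%-mod (exponent v∈) p)) (sym (power v∈))) })
      }
    where
    exponent : ∀ {v} → v ∈ ⟨ G ⟩ u → ℕ
    exponent v∈ = proj₁ (∈⟨⟩⇒power v∈)
    power : ∀ {v} (v∈ : v ∈ ⟨ G ⟩ u) → v ≈ exponent v∈ · u
    power v∈ = proj₂ (∈⟨⟩⇒power v∈)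
    index : ∀ {v} → v ∈ ⟨ G ⟩ u → Fin p
    index v∈ = Fin.fromℕ< (m%n<n (exponent v∈) p)
    toℕ-index : ∀ {v} (v∈ : v ∈ ⟨ G ⟩ u) → Fin.toℕ (index v∈) ≡ exponent v∈ % p
    toℕ-index v∈ = Finₚ.toℕ-fromℕ< (m%n<n (exponent v∈) p)
    index-cong : ∀ {v w} (v∈ : v ∈ ⟨ G ⟩ u) (w∈ : w ∈ ⟨ G ⟩ u) → v ≈ w → index v∈ ≡ index w∈
    index-cong v∈ w∈ v≈w = Finₚ.fromℕ<-cong _ _
      (exponents-mod prime-u (trans (sym (power v∈)) (trans v≈w (power w∈)))) _ _

  same-subgroup : ∀ {u v} → u ∈ ⟨ G ⟩ v → v ∈ ⟨ G ⟩ u → ⟨ G ⟩ u ≐ ⟨ G ⟩ v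
  same-subgroup u∈ v∈ = (λ w∈ → ⟨⟩-trans w∈ u∈) , (λ w∈ → ⟨⟩-trans w∈ v∈)

  -- A nontrivial element of `H` has a power `u` of order `p`, and the `p` distinct powers of `u`
  -- exhaust the `p` elements of `H`.
  subgroup-generator : (H : 𝓗.Carrier) → ∃[ u ] (HasPrimeOrder u × ⟨ G ⟩ u ≐ proj₁ H)
  subgroup-generator (H , isSubgroup , |H|) = u , prime-u , generated⊆H , H⊆generated
    where
    open IsSubgroup isSubgroup
    open Inverse |H| using (to; from; to-cong; strictlyInverseˡ; strictlyInverseʳ)
    1<p : 1 < p
    1<p = nonTrivial⇒n>1 p {{prime⇒nonTrivial p-prime}}
    i₀ i₁ : Fin p
    i₀ = Fin.fromℕ< (ℕₚ.<-trans (s≤s z≤n) 1<p)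
    i₁ = Fin.fromℕ< 1<p
    i₀≢i₁ : i₀ ≢ i₁
    i₀≢i₁ eq with () ← ≡.trans (≡.sym (Finₚ.toℕ-fromℕ< (ℕₚ.<-trans (s≤s z≤n) 1<p)))
                         (≡.trans (cong Fin.toℕ eq) (Finₚ.toℕ-fromℕ< 1<p))
    nontrivial : ∃[ h ] (H h × h ≉ ε)
    nontrivial with proj₁ (from i₀) ≟ ε | proj₁ (from i₁) ≟ ε
    ... | no h≉ε   | _         = _ , proj₂ (from i₀) , h≉ε
    ... | yes _    | no h≉ε    = _ , proj₂ (from i₁) , h≉ε
    ... | yes h₀≈ε | yes h₁≈ε  = contradiction
      (≡.trans (≡.sym (strictlyInverseˡ i₀))
        (≡.trans (to-cong (trans h₀≈ε (sym h₁≈ε))) (strictlyInverseˡ i₁))) i₀≢i₁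
    h = proj₁ nontrivial
    b = proj₁ (socle (proj₂ (proj₂ nontrivial)))
    u : Carrier
    u = p ^ b · h
    prime-u : HasPrimeOrder u
    prime-u = proj₂ (socle (proj₂ (proj₂ nontrivial)))
    power∈H : ∀ n {h} → H h → H (n · h)
    power∈H zero    h∈ = ε-closed
    power∈H (suc n) h∈ = ∙-closed h∈ (power∈H n h∈)
    u∈H : H u
    u∈H = power∈H (p ^ b) (proj₁ (proj₂ nontrivial))
    generated⊆H : ⟨ G ⟩ u ⊆ H
    generated⊆H v∈ = let s , v≈ = ∈⟨⟩⇒power v∈ in ∈-resp-≈ (sym v≈) (power∈H s u∈H)
    index : Fin p → Fin p
    index i = to (Fin.toℕ i · u , power∈H (Fin.toℕ i) u∈H)
    index-injective : Injective _≡_ _≡_ index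
    index-injective {i} {j} eq = Finₚ.toℕ-injective (≡.trans (≡.sym (m<n⇒m%n≡m (Finₚ.toℕ<n i)))
      (≡.trans (exponents-mod prime-u (trans (sym (strictlyInverseʳ _)) (trans (reflexive (cong (proj₁ ∘ from) eq)) (strictlyInverseʳ _))))
               (m<n⇒m%n≡m (Finₚ.toℕ<n j))))
    H⊆generated : H ⊆ ⟨ G ⟩ u
    H⊆generated {v} v∈ = let i , eq = injective⇒surjective index-injective ℕₚ.≤-refl (to (v , v∈)) in
      resp (trans (sym (strictlyInverseʳ _)) (trans (reflexive (cong (proj₁ ∘ from) eq)) (strictlyInverseʳ _)))
           (power∈ (Fin.toℕ i) u)

module _ (G : Group c ℓ) (p a : ℕ) (p-prime : Prime p) (|G| : HasOrder G (p ^ a))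
         (p-odd : ¬ (2 ∣ p)) (nilpotent : IsNilpotent G) (¬cyclic : ¬ IsCyclic G)
         {r : ℕ} (|𝓗| : HasCardinality (subgroupsOfOrder G p) r) where
  open Group G
  open Powers G
  open PGroup G p a p-prime |G|
  open PrimeSubgroups G p a p-prime |G|
  private
    module 𝓗 = Inverse |𝓗|
    module ≐ = Setoid (subgroupsOfOrder G p)

  subgroupIndex : ∀ {u} → HasPrimeOrder u → Fin r
  subgroupIndex prime-u = 𝓗.to (prime-order-subgroup prime-u)

  subgroupIndex-injective : ∀ {u v} (prime-u : HasPrimeOrder u) (prime-v : HasPrimeOrder v) →
                            subgroupIndex prime-u ≡ subgroupIndex prime-v → u ∈ ⟨ G ⟩ v
  subgroupIndex-injective prime-u prime-v eq = proj₁ same (gen refl)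
    where
    same : proj₁ (prime-order-subgroup prime-u) ≐ proj₁ (prime-order-subgroup prime-v)
    same = ≐.trans {prime-order-subgroup prime-u} {𝓗.from (subgroupIndex prime-u)} {prime-order-subgroup prime-v}
      (≐.sym {𝓗.from (subgroupIndex prime-u)} {prime-order-subgroup prime-u} (𝓗.strictlyInverseʳ _))
      (𝓗.inverseʳ eq)

  2≤#subgroups : 2 ≤ r
  2≤#subgroups with 2 ℕₚ.≤? r
  ... | yes 2≤r = 2≤r
  ... | no 2≰r  = contradiction (unique-prime-order⇒cyclic p-odd nilpotent λ {u} {v} prime-u prime-v →
          subgroupIndex-injective prime-u prime-v (≤1-unique (ℕₚ.≰⇒> 2≰r) _ _)) ¬cyclic
    where
    ≤1-unique : ∀ {r} → r < 2 → (i j : Fin r) → i ≡ j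
    ≤1-unique (s≤s (s≤s z≤n)) fzero fzero = ≡.refl

  primeSubgroupCoordinate : Coordinate G r
  primeSubgroupCoordinate = record
    { _≟_            = _≟_
    ; 2≤r            = 2≤#subgroups
    ; class          = class
    ; class-cong     = class-cong
    ; rep            = rep
    ; class-rep      = class-rep
    ; joined-class   = joined-class
    ; joined-rep     = joined-rep
    ; trivial-joined = trivial-joined
    }
    where
    index : ∀ {u} → u ≉ ε → Fin r
    index u≉ε = subgroupIndex (proj₂ (socle u≉ε))
    class : Carrier → Maybe (Fin r)
    class u with u ≟ ε
    ... | yes _  = nothing
    ... | no u≉ε = just (index u≉ε)
    -- The order-p powers of `u` and `v` lie in a common ⟨ w ⟩, which has only one subgroup of order
    -- `p`. Applied to equal elements, this makes `class` respect ≈ whatever proofs of nontriviality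
    -- `index` receives.
    index-joined : ∀ {u v} (u≉ε : u ≉ ε) (v≉ε : v ≉ ε) → Joined G u v → index u≉ε ≡ index v≉ε
    index-joined {u} {v} u≉ε v≉ε (w , u∈ , v∈) = 𝓗.to-cong
      {prime-order-subgroup (proj₂ (socle u≉ε))} {prime-order-subgroup (proj₂ (socle v≉ε))}
      (same-subgroup (cyclic-prime-order prime-u prime-v u′∈ v′∈) (cyclic-prime-order prime-v prime-u v′∈ u′∈))
      where
      prime-u = proj₂ (socle u≉ε)
      prime-v = proj₂ (socle v≉ε)
      u′∈ = ⟨⟩-trans (power∈ (p ^ proj₁ (socle u≉ε)) u) u∈
      v′∈ = ⟨⟩-trans (power∈ (p ^ proj₁ (socle v≉ε)) v) v∈
    class-cong : ∀ {u v} → u ≈ v → class u ≡ class v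
    class-cong {u} {v} u≈v with u ≟ ε | v ≟ ε
    ... | yes _   | yes _   = ≡.refl
    ... | yes u≈ε | no v≉ε  = contradiction (trans (sym u≈v) u≈ε) v≉ε
    ... | no u≉ε  | yes v≈ε = contradiction (trans u≈v v≈ε) u≉ε
    ... | no u≉ε  | no v≉ε  = cong just (index-joined u≉ε v≉ε (v , gen u≈v , gen refl))
    generator : ∀ i → ∃[ u ] (HasPrimeOrder u × ⟨ G ⟩ u ≐ proj₁ (𝓗.from i))
    generator i = subgroup-generator (𝓗.from i)
    rep : Fin r → Carrier
    rep i = proj₁ (generator i)
    prime-rep : ∀ i → HasPrimeOrder (rep i)
    prime-rep i = proj₁ (proj₂ (generator i))
    subgroupIndex-rep : ∀ i → subgroupIndex (prime-rep i) ≡ i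
    subgroupIndex-rep i = 𝓗.inverseˡ {i} {prime-order-subgroup (prime-rep i)} (proj₂ (proj₂ (generator i)))
    index-rep : ∀ i (rep≉ε : rep i ≉ ε) → index rep≉ε ≡ i
    index-rep i rep≉ε = ≡.trans (𝓗.to-cong {prime-order-subgroup (proj₂ (socle rep≉ε))} {prime-order-subgroup (prime-rep i)}
      (same-subgroup (power∈ n (rep i)) (cyclic-prime-order (prime-rep i) (proj₂ (socle rep≉ε)) (gen refl) (power∈ n (rep i)))))
      (subgroupIndex-rep i)
      where n = p ^ proj₁ (socle rep≉ε)
    -- The premise ranges over all proofs of `u ≉ ε` because `class` chooses its own.
    class-nontrivial : ∀ {u i} → u ≉ ε → (∀ u≉ε → index {u} u≉ε ≡ i) → class u ≡ just i
    class-nontrivial {u} u≉ε index≡i with u ≟ ε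
    ... | yes u≈ε  = contradiction u≈ε u≉ε
    ... | no u≉ε′  = cong just (index≡i u≉ε′)
    class-rep : ∀ i → class (rep i) ≡ just i
    class-rep i = class-nontrivial (proj₁ (prime-rep i)) (index-rep i)
    joined-class : ∀ {u v a b} → Joined G u v → class u ≡ just a → class v ≡ just b → a ≡ b
    joined-class {u} {v} u—v ua vb with u ≟ ε | v ≟ ε
    joined-class u—v ≡.refl ≡.refl | no u≉ε | no v≉ε = index-joined u≉ε v≉ε u—v
    joined-rep : ∀ {u i} → class u ≡ just i → Joined G u (rep i)
    joined-rep {u} {i} ui with u ≟ ε
    joined-rep {u} {i} ≡.refl | no u≉ε = u , gen refl ,
      ⟨⟩-trans (subgroupIndex-injective (prime-rep (index u≉ε)) (proj₂ (socle u≉ε)) (subgroupIndex-rep (index u≉ε)))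
               (power∈ (p ^ proj₁ (socle u≉ε)) u)
    trivial-joined : ∀ {u} → class u ≡ nothing → ∀ v → Joined G u v
    trivial-joined {u} uₙ v with u ≟ ε
    ... | yes u≈ε = v , resp (sym u≈ε) one , gen refl

-- Generalized quaternion groups

-- Models the maximal cyclic subgroups of a generalized quaternion group, any two of which meet in ⟨
-- centre ⟩. By `involution∉` a generator differs from its inverse, which can then serve as `twin`.
record CyclicCover (G : Group c ℓ) (r : ℕ) : Set (c ⊔ ℓ) where
  open Group G
  field
    generator : Fin r → Carrier
    centre    : Carrier
    covered   : ∀ u → ∃[ i ] u ∈ ⟨ G ⟩ (generator i)
    meets     : ∀ {i j u} → i ≢ j → u ∈ ⟨ G ⟩ (generator i) → u ∈ ⟨ G ⟩ (generator j) → u ∈ ⟨ G ⟩ centre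
    centre∈   : ∀ i → centre ∈ ⟨ G ⟩ (generator i)
    generator∉ : ∀ i → ¬ (generator i ∈ ⟨ G ⟩ centre)
    involution∉ : ∀ i → generator i ∙ generator i ≉ ε

-- An element outside ⟨ centre ⟩ lies in exactly one covering subgroup, which gives its class. Every
-- ⟨ w ⟩ is contained in a covering subgroup, so joined elements outside ⟨ centre ⟩ share their
-- class.
cover⇒cliques : ∀ {G : Group c ℓ} {n r} → HasOrder G n → 2 ≤ r → CyclicCover G r → CliquePartition G r
cover⇒cliques {G = G} {n} {r} |G| 2≤r cover = record
  { _≟_            = _≟_
  ; 2≤r            = 2≤r
  ; class          = class
  ; class-cong     = class-cong
  ; rep            = generator
  ; twin           = λ i → generator i ⁻¹
  ; class-rep      = λ i → class-generator (generator∉ i) (gen refl)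
  ; class-twin     = λ i → class-generator
      (λ g⁻¹∈ → generator∉ i (resp (⁻¹-involutive _) (inv g⁻¹∈))) (inv (gen refl))
  ; rep≉twin       = λ i g≈g⁻¹ → involution∉ i (trans (∙-congˡ g≈g⁻¹) (inverseʳ _))
  ; joined-class   = joined-class
  ; clique         = λ ua va → _ , class⇒∈ ua , class⇒∈ va
  ; trivial-joined = λ uₙ v → let i , v∈ = covered v in
      generator i , ⟨⟩-trans (class⇒central uₙ) (centre∈ i) , v∈
  }
  where
  open Group G
  open Powers G
  open Finite G n |G|
  open CyclicCover cover

  class : Carrier → Maybe (Fin r)
  class u with u ∈⟨ centre ⟩?
  ... | yes _ = nothing
  ... | no _  = just (proj₁ (covered u))

  class-generator : ∀ {u i} → ¬ (u ∈ ⟨ G ⟩ centre) → u ∈ ⟨ G ⟩ (generator i) → class u ≡ just i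
  class-generator {u} {i} u∉ u∈ with u ∈⟨ centre ⟩?
  ... | yes u∈z = contradiction u∈z u∉
  ... | no _ with proj₁ (covered u) Fin.≟ i
  ...   | yes eq = cong just eq
  ...   | no ≢i  = contradiction (meets ≢i (proj₂ (covered u)) u∈) u∉

  class⇒∈ : ∀ {u i} → class u ≡ just i → u ∈ ⟨ G ⟩ (generator i)
  class⇒∈ {u} ui with u ∈⟨ centre ⟩?
  class⇒∈ {u} ≡.refl | no _ = proj₂ (covered u)

  class⇒∉ : ∀ {u i} → class u ≡ just i → ¬ (u ∈ ⟨ G ⟩ centre)
  class⇒∉ {u} ui with u ∈⟨ centre ⟩?
  class⇒∉ {u} ≡.refl | no u∉ = u∉

  class⇒central : ∀ {u} → class u ≡ nothing → u ∈ ⟨ G ⟩ centre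
  class⇒central {u} uₙ with u ∈⟨ centre ⟩?
  ... | yes u∈ = u∈

  joined-class : ∀ {u v a b} → Joined G u v → class u ≡ just a → class v ≡ just b → a ≡ b
  joined-class (w , u∈ , v∈) ua vb = let i , w∈ = covered w in just-injective
    (≡.trans (≡.sym ua) (≡.trans (class-generator (class⇒∉ ua) (⟨⟩-trans u∈ w∈))
      (≡.trans (≡.sym (class-generator (class⇒∉ vb) (⟨⟩-trans v∈ w∈))) vb)))

  class-cong : ∀ {u v} → u ≈ v → class u ≡ class v
  class-cong {u} {v} u≈v with class v in vb
  ... | just b  = class-generator (λ u∈ → class⇒∉ vb (resp u≈v u∈)) (resp (sym u≈v) (class⇒∈ vb))
  ... | nothing = ¬just⇒nothing λ (a , ua) → class⇒∉ ua (resp (sym u≈v) (class⇒central vb))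

module _ {Q : Group c ℓ} (d : ℕ) (Q-quaternion : IsGeneralizedQuaternion Q (3 + d)) where
  open Group Q
  open Powers Q
  open IsGeneralizedQuaternion Q-quaternion renaming (conjugate to yxy⁻¹≈x⁻¹)
  open Finite Q (2 ^ (3 + d)) order
  open import Relation.Binary.Reasoning.Setoid setoid
  private
    -- For `k = 3 + d`: `K` is 2^(k-2), so x^K = y²; `T` is 2^(k-1), which annihilates `x`; and `s`
    -- plays the role of -1 modulo `T`.
    K T s : ℕ
    K = 2 ^ (1 + d)
    T = 2 * K
    s = T ∸ 1

    instance
      K≢0 : NonZero K
      K≢0 = ℕₚ.m^n≢0 2 (1 + d)
      T≢0 : NonZero T
      T≢0 = ℕₚ.m^n≢0 2 (2 + d)

    1+s≡T : 1 + s ≡ T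
    1+s≡T = ℕₚ.suc-pred T

    1<K : 1 < K
    1<K = ℕₚ.*-monoʳ-≤ 2 {1} {2 ^ d} (ℕₚ.m^n>0 2 d)

    K<T : K < T
    K<T = subst (K <_) (cong (K +_) (≡.sym (ℕₚ.+-identityʳ K))) (ℕₚ.m<m+n K (ℕₚ.<-trans (s≤s z≤n) 1<K))

    2<T : 2 < T
    2<T = ℕₚ.≤-<-trans 1<K K<T

    x⁻¹-power : s · x ≈ x ⁻¹
    x⁻¹-power = inverseʳ-unique x _ (trans (×-congˡ 1+s≡T) x-power)

    y-past-x : ∀ n → y ∙ n · x ≈ (n * s) · x ∙ y
    y-past-x = move-past (trans yxy⁻¹≈x⁻¹ (sym x⁻¹-power))

    y∙y : y ∙ y ≈ K · x
    y∙y = trans (∙-congˡ (sym (identityʳ y))) (sym y-square)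

    xy-∙-x : ∀ m n → (m · x ∙ y) ∙ n · x ≈ (m + n * s) · x ∙ y
    xy-∙-x m n = begin
      (m · x ∙ y) ∙ n · x         ≈⟨ assoc _ _ _ ⟩
      m · x ∙ (y ∙ n · x)         ≈⟨ ∙-congˡ (y-past-x n) ⟩
      m · x ∙ ((n * s) · x ∙ y)   ≈⟨ assoc _ _ _ ⟨
      (m · x ∙ (n * s) · x) ∙ y   ≈⟨ ∙-congʳ (×-homo-+ x m (n * s)) ⟨
      (m + n * s) · x ∙ y         ∎

    xy-∙-xy : ∀ m n → (m · x ∙ y) ∙ (n · x ∙ y) ≈ (m + n * s + K) · x
    xy-∙-xy m n = begin
      (m · x ∙ y) ∙ (n · x ∙ y)    ≈⟨ assoc _ _ _ ⟨
      ((m · x ∙ y) ∙ n · x) ∙ y    ≈⟨ ∙-congʳ (xy-∙-x m n) ⟩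
      ((m + n * s) · x ∙ y) ∙ y    ≈⟨ assoc _ _ _ ⟩
      (m + n * s) · x ∙ (y ∙ y)    ≈⟨ ∙-congˡ y∙y ⟩
      (m + n * s) · x ∙ K · x      ≈⟨ ×-homo-+ x (m + n * s) K ⟨
      (m + n * s + K) · x          ∎

    x-∙-xy : ∀ m n → m · x ∙ (n · x ∙ y) ≈ (m + n) · x ∙ y
    x-∙-xy m n = trans (sym (assoc _ _ _)) (∙-congʳ (sym (×-homo-+ x m n)))

    NormalForm : Carrier → Set ℓ
    NormalForm u = ∃[ i ] (u ≈ i · x ⊎ u ≈ i · x ∙ y)

    -- Since y x^n = x^(ns) y and y² = x^K, the elements x^i and x^i y are closed under products.
    normal-form : ∀ u → NormalForm u
    normal-form u = generated⊆ NormalForm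
      (λ { u≈v (i , inj₁ eq) → i , inj₁ (trans (sym u≈v) eq) ; u≈v (i , inj₂ eq) → i , inj₂ (trans (sym u≈v) eq) })
      (0 , inj₁ refl)
      (λ { (m , inj₁ u≈) (n , inj₁ v≈) → m + n , inj₁ (trans (∙-cong u≈ v≈) (sym (×-homo-+ x m n)))
         ; (m , inj₁ u≈) (n , inj₂ v≈) → m + n , inj₂ (trans (∙-cong u≈ v≈) (x-∙-xy m n))
         ; (m , inj₂ u≈) (n , inj₁ v≈) → m + n * s , inj₂ (trans (∙-cong u≈ v≈) (xy-∙-x m n))
         ; (m , inj₂ u≈) (n , inj₂ v≈) → m + n * s + K , inj₁ (trans (∙-cong u≈ v≈) (xy-∙-xy m n)) })
      (λ { (inj₁ u≈x) → 1 , inj₁ (trans u≈x (sym (×-homo-1 x)))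
         ; (inj₂ u≈y) → 0 , inj₂ (trans u≈y (sym (identityˡ y))) })
      (generated u)

    point : Fin 2 × Fin T → Carrier
    point (fzero  , i) = Fin.toℕ i · x
    point (fsuc _ , i) = Fin.toℕ i · x ∙ y

    residue : ℕ → Fin T
    residue i = Fin.fromℕ< (m%n<n i T)

    residue-power : ∀ i → Fin.toℕ (residue i) · x ≈ i · x
    residue-power i = trans (×-congˡ (Finₚ.toℕ-fromℕ< (m%n<n i T))) (mod-· x-power (%-mod i T))

    residue-mod : ∀ {i i′} → residue i ≡ residue i′ → i ≡ i′ [mod T ]
    residue-mod {i} {i′} eq = mod-trans (mod-sym (%-mod i T)) (subst (_≡ i′ [mod T ]) i′%T≡i%T (%-mod i′ T))
      where
      i′%T≡i%T : i′ % T ≡ i % T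
      i′%T≡i%T = ≡.trans (≡.sym (Finₚ.toℕ-fromℕ< (m%n<n i′ T)))
        (≡.trans (cong Fin.toℕ (≡.sym eq)) (Finₚ.toℕ-fromℕ< (m%n<n i T)))

    point-surjective : ∀ u → ∃[ b ] u ≈ point b
    point-surjective u with normal-form u
    ... | i , inj₁ eq = (fzero , residue i) , trans eq (sym (residue-power i))
    ... | i , inj₂ eq = (fsuc fzero , residue i) , trans eq (∙-congʳ (sym (residue-power i)))

    open Inverse order using (to; from; strictlyInverseˡ; to-cong)

    -- The group order `2 ^ (3 + d)` unfolds to `2 * T`, so numbering the elements by their normal
    -- forms is a map from `Fin (2 * T)` to itself; being injective, it is onto.
    code : Fin (2 * T) → Fin (2 * T)
    code z = let (b , i) , _ = point-surjective (from z) in Fin.combine b i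

    point-code : ∀ z → from z ≈ point (Fin.remQuot T (code z))
    point-code z = trans (proj₂ (point-surjective (from z)))
      (reflexive (cong point (≡.sym (Finₚ.remQuot-combine (proj₁ b) (proj₂ b)))))
      where b = proj₁ (point-surjective (from z))

    from-injective : ∀ {z w} → from z ≈ from w → z ≡ w
    from-injective {z} {w} eq = ≡.trans (≡.sym (strictlyInverseˡ z)) (≡.trans (to-cong eq) (strictlyInverseˡ w))

    code-injective : Injective _≡_ _≡_ code
    code-injective {z} {w} eq = from-injective
      (trans (point-code z) (trans (reflexive (cong (point ∘ Fin.remQuot T) eq)) (sym (point-code w))))

    -- The 2 T normal forms exhaust a group of order 2 T, so they are distinct.
    abstract
      point-injective : ∀ {b d} → point b ≈ point d → b ≡ d
      point-injective {b} {d} eq = ≡.trans (≡.sym (code-preimage b)) (≡.trans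
        (cong (Fin.remQuot T ∘ code) (from-injective (trans (preimage-point b) (trans eq (sym (preimage-point d))))))
        (code-preimage d))
        where
        preimage : Fin 2 × Fin T → Fin (2 * T)
        preimage (b , i) = proj₁ (injective⇒surjective code-injective ℕₚ.≤-refl (Fin.combine b i))
        code-preimage : ∀ b → Fin.remQuot T (code (preimage b)) ≡ b
        code-preimage (b , i) = ≡.trans
          (cong (Fin.remQuot T) (proj₂ (injective⇒surjective code-injective ℕₚ.≤-refl (Fin.combine b i))))
          (Finₚ.remQuot-combine b i)
        preimage-point : ∀ b → from (preimage b) ≈ point b
        preimage-point b = trans (point-code (preimage b)) (reflexive (cong point (code-preimage b)))

    x-powers : ∀ {m n} → m · x ≈ n · x → m ≡ n [mod T ]
    x-powers {m} {n} eq = residue-mod (cong proj₂ (point-injective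
      {fzero , residue m} {fzero , residue n} (trans (residue-power m) (trans eq (sym (residue-power n))))))

    x≉xy : ∀ {m n} → ¬ (m · x ≈ n · x ∙ y)
    x≉xy {m} {n} eq with () ← point-injective {fzero , residue m} {fsuc fzero , residue n}
      (trans (residue-power m) (trans eq (∙-congʳ (sym (residue-power n)))))

    -- `y` inverts `x`, so the two copies of x^i cancel and y² remains.
    xy-square : ∀ i → (i · x ∙ y) ∙ (i · x ∙ y) ≈ K · x
    xy-square i = trans (xy-∙-xy i i) (mod-· x-power
      (subst (_≡ K [mod T ]) (≡.sym (≡.trans (regroup i s K) (cong (λ t → i * t + K) 1+s≡T)))
        (mod-+ (multiple-mod i) mod-refl)))
      where
      regroup : ∀ i s K → i + i * s + K ≡ i * (1 + s) + K
      regroup = solve-∀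

    -- Exponents are recorded only up to multiples of `K`, which is enough to recover `i` modulo `K`
    -- from a power outside the centre.
    xy-powers : ∀ i t → ∃[ j ] (t · (i · x ∙ y) ≈ (j * K) · x ⊎ t · (i · x ∙ y) ≈ (i + j * K) · x ∙ y)
    xy-powers i zero = 0 , inj₁ refl
    xy-powers i (suc t) with xy-powers i t
    ... | j , inj₁ eq = j * s , inj₂ (trans (∙-congˡ eq) (trans (xy-∙-x i (j * K))
            (∙-congʳ (×-congˡ (cong (i +_) (regroup j K s))))))
      where
      regroup : ∀ j K s → j * K * s ≡ j * s * K
      regroup = solve-∀
    ... | j , inj₂ eq = 2 * i + j * s + 1 , inj₁ (trans (∙-congˡ eq) (trans (xy-∙-xy i (i + j * K))
            (×-congˡ (≡.trans (regroup i j s K) (≡.trans (cong (λ t → i * t + (j * s + 1) * K) 1+s≡T) (regroup′ i j s K))))))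
      where
      regroup : ∀ i j s K → i + (i + j * K) * s + K ≡ i * (1 + s) + (j * s + 1) * K
      regroup = solve-∀
      regroup′ : ∀ i j s K → i * (2 * K) + (j * s + 1) * K ≡ (2 * i + j * s + 1) * K
      regroup′ = solve-∀

    centre-power∈ : ∀ t → (t * K) · x ∈ ⟨ Q ⟩ (K · x)
    centre-power∈ t = resp (×-assocˡ x t K) (power∈ t (K · x))

    -- Exponents `i` below `K` suffice for the elements x^i y, since ⟨ x^i y ⟩ also contains x^(i+K)
    -- y. Together with `x` this gives 2^(k-2) + 1 subgroups.
    gens : Fin (suc K) → Carrier
    gens fzero    = x
    gens (fsuc i) = Fin.toℕ i · x ∙ y

    centre∈gens : ∀ i → K · x ∈ ⟨ Q ⟩ (gens i)
    centre∈gens fzero    = power∈ K x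
    centre∈gens (fsuc i) = resp (xy-square (Fin.toℕ i)) (mul (gen refl) (gen refl))

    x-meets-xy : ∀ {u} i → u ∈ ⟨ Q ⟩ x → u ∈ ⟨ Q ⟩ (i · x ∙ y) → u ∈ ⟨ Q ⟩ (K · x)
    x-meets-xy i u∈x u∈g with m , u≈m ← ∈⟨⟩⇒power u∈x | t , u≈t ← ∈⟨⟩⇒power u∈g with xy-powers i t
    ... | j , inj₁ eq = resp (sym (trans u≈t eq)) (centre-power∈ j)
    ... | j , inj₂ eq = contradiction (trans (sym u≈m) (trans u≈t eq)) (x≉xy {m} {i + j * K})

    -- A common element outside ⟨ x^K ⟩ would equal both x^(i+jK) y and x^(i′+j′K) y, so `i` and
    -- `i′` would agree modulo `K` and hence coincide.
    xy-meets-xy : ∀ {u} {i i′ : Fin K} → i ≢ i′ → u ∈ ⟨ Q ⟩ (gens (fsuc i)) → u ∈ ⟨ Q ⟩ (gens (fsuc i′)) →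
                  u ∈ ⟨ Q ⟩ (K · x)
    xy-meets-xy {i = i} {i′} i≢i′ u∈ u∈′ with t , u≈ ← ∈⟨⟩⇒power u∈ | t′ , u≈′ ← ∈⟨⟩⇒power u∈′
      with xy-powers (Fin.toℕ i) t | xy-powers (Fin.toℕ i′) t′
    ... | j , inj₁ eq | _           = resp (sym (trans u≈ eq)) (centre-power∈ j)
    ... | _           | j , inj₁ eq = resp (sym (trans u≈′ eq)) (centre-power∈ j)
    ... | j , inj₂ eq | j′ , inj₂ eq′ = contradiction (Finₚ.toℕ-injective i≡i′) i≢i′
      where
      exponents : Fin.toℕ i + j * K ≡ Fin.toℕ i′ + j′ * K [mod K ]
      exponents = mod-∣ (divides 2 ≡.refl)
        (x-powers (∙-cancelʳ y _ _ (trans (sym eq) (trans (sym u≈) (trans u≈′ eq′)))))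
      reduce : ∀ (i : Fin K) j → (Fin.toℕ i + j * K) % K ≡ Fin.toℕ i
      reduce i j = ≡.trans ([m+kn]%n≡m%n (Fin.toℕ i) j K) (m<n⇒m%n≡m (Finₚ.toℕ<n i))
      i≡i′ : Fin.toℕ i ≡ Fin.toℕ i′
      i≡i′ = ≡.trans (≡.sym (reduce i j)) (≡.trans (mod⇒% exponents) (reduce i′ j′))

  quaternion-cover : CyclicCover Q (suc K)
  quaternion-cover = record
    { generator   = gens
    ; centre      = K · x
    ; covered     = covered
    ; meets       = meets
    ; centre∈     = centre∈gens
    ; generator∉  = generator∉
    ; involution∉ = involution∉
    }
    where
    covered : ∀ u → ∃[ i ] u ∈ ⟨ Q ⟩ (gens i)
    covered u with normal-form u
    ... | i , inj₁ u≈ = fzero , resp (sym u≈) (power∈ i x)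
    -- `q` is `i` modulo `K`; the remaining factor is a power of x^K, which lies in every covering
    -- subgroup.
    ... | i , inj₂ u≈ = fsuc q , resp (sym (begin
        u                                         ≈⟨ u≈ ⟩
        i · x ∙ y                                 ≈⟨ ∙-congʳ (×-congˡ i≡) ⟩
        (i / K * K + Fin.toℕ q) · x ∙ y           ≈⟨ x-∙-xy (i / K * K) (Fin.toℕ q) ⟨
        (i / K * K) · x ∙ (Fin.toℕ q · x ∙ y)     ∎))
        (mul (⟨⟩-trans (centre-power∈ (i / K)) (centre∈gens (fsuc q))) (gen refl))
      where
      q : Fin K
      q = Fin.fromℕ< (m%n<n i K)
      i≡ : i ≡ i / K * K + Fin.toℕ q
      i≡ = ≡.trans (m≡m%n+[m/n]*n i K) (≡.trans (ℕₚ.+-comm (i % K) _)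
        (cong (i / K * K +_) (≡.sym (Finₚ.toℕ-fromℕ< (m%n<n i K)))))
    meets : ∀ {i j u} → i ≢ j → u ∈ ⟨ Q ⟩ (gens i) → u ∈ ⟨ Q ⟩ (gens j) → u ∈ ⟨ Q ⟩ (K · x)
    meets {fzero}  {fzero}  i≢j _  _  = contradiction ≡.refl i≢j
    meets {fzero}  {fsuc j} _   u∈ u∈′ = x-meets-xy (Fin.toℕ j) u∈ u∈′
    meets {fsuc i} {fzero}  _   u∈ u∈′ = x-meets-xy (Fin.toℕ i) u∈′ u∈
    meets {fsuc i} {fsuc j} i≢j u∈ u∈′ = xy-meets-xy (i≢j ∘ cong fsuc) u∈ u∈′
    generator∉ : ∀ i → ¬ (gens i ∈ ⟨ Q ⟩ (K · x))
    -- If `x` were a power of x^K, then 1 would be 0 modulo `K`, against `1 < K`.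
    generator∉ fzero x∈ with t , x≈ ← ∈⟨⟩⇒power x∈ = contradiction 1≡0 λ ()
      where
      1≡tK : 1 ≡ t * K [mod K ]
      1≡tK = mod-∣ (divides 2 ≡.refl) (x-powers (trans (×-homo-1 x) (trans x≈ (×-assocˡ x t K))))
      1≡0 : 1 ≡ 0
      1≡0 = ≡.trans (≡.sym (m<n⇒m%n≡m 1<K)) (≡.trans (mod⇒% (mod-trans 1≡tK (multiple-mod t)))
              (m<n⇒m%n≡m (ℕₚ.<-trans (s≤s z≤n) 1<K)))
    generator∉ (fsuc i) g∈ with t , g≈ ← ∈⟨⟩⇒power g∈ =
      x≉xy {t * K} {Fin.toℕ i} (sym (trans g≈ (×-assocˡ x t K)))
    nonzero-power : ∀ {n} → 0 < n → n < T → ¬ (n · x ≈ ε)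
    nonzero-power {n} 0<n n<T eq = ℕₚ.<⇒≢ 0<n (≡.sym (≡.trans (≡.sym (m<n⇒m%n≡m n<T))
      (≡.trans (mod⇒% (x-powers {n} {0} eq)) (m<n⇒m%n≡m (ℕₚ.<-trans (s≤s z≤n) 2<T)))))
    involution∉ : ∀ i → gens i ∙ gens i ≉ ε
    involution∉ fzero    xx≈ε = nonzero-power (s≤s z≤n) 2<T (trans (∙-congˡ (identityʳ x)) xx≈ε)
    involution∉ (fsuc i) gg≈ε = nonzero-power (ℕₚ.<-trans (s≤s z≤n) 1<K) K<T (trans (sym (xy-square (Fin.toℕ i))) gg≈ε)

  quaternion-cliques : CliquePartition Q (suc K)
  quaternion-cliques = cover⇒cliques order (ℕₚ.≤-trans 1<K (ℕₚ.n≤1+n K)) quaternion-cover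

-- Direct products

-- Elements of `P i` are lifted by ε in the other factors; commutators are computed componentwise,
-- so the upper central series projects.
nilpotent-factor : ∀ {m} (P : Fin m → Group c ℓ) → IsNilpotent (Π P) → ∀ i → IsNilpotent (P i)
nilpotent-factor P (n , upper) i = n , λ g → subst (_∈ UpperCentral (P i) n) (extend-≡ g) (project (upper (extend g)))
  where
  extend : Group.Carrier (P i) → Group.Carrier (Π P)
  extend g j with i Fin.≟ j
  ... | yes ≡.refl = g
  ... | no _       = Group.ε (P j)
  extend-≡ : ∀ g → extend g i ≡ g
  extend-≡ g with i Fin.≟ i
  ... | yes ≡.refl = ≡.refl
  ... | no i≢i     = contradiction ≡.refl i≢i
  project : ∀ {n g} → g ∈ UpperCentral (Π P) n → g i ∈ UpperCentral (P i) n
  project (base g≈ε)           = base (g≈ε i)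
  project {suc n} {g} (step lower) = step λ h →
    subst (λ h → ((g i ∙ h) ∙ g i ⁻¹) ∙ h ⁻¹ ∈ UpperCentral (P i) n) (extend-≡ h) (project (lower (extend h)))
    where open Group (P i)

module _ {G : Group c ℓ} {H : Group v e} where
  private
    module G = Group G
    module H = Group H

  order-× : ∀ {m n} → HasOrder G m → HasOrder H n → HasOrder (G ×ᴳ H) (m * n)
  order-× {m} {n} |G| |H| = record
    { to        = λ (g , h) → Fin.combine (|G|.to g) (|H|.to h)
    ; from      = λ i → let j , k = Fin.remQuot {m} n i in |G|.from j , |H|.from k
    ; to-cong   = λ (g≈ , h≈) → ≡.cong₂ Fin.combine (|G|.to-cong g≈) (|H|.to-cong h≈)
    ; from-cong = λ { ≡.refl → G.refl , H.refl }
    ; inverse   = (λ {i} (g≈ , h≈) → ≡.trans (≡.cong₂ Fin.combine (|G|.inverseˡ g≈) (|H|.inverseˡ h≈))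
                                             (Finₚ.combine-remQuot {m} n i))
                , (λ { {g , h} ≡.refl → subst (λ (j , k) → (|G|.from j G.≈ g) × (|H|.from k H.≈ h))
                         (≡.sym (Finₚ.remQuot-combine (|G|.to g) (|H|.to h)))
                         (|G|.strictlyInverseʳ g , |H|.strictlyInverseʳ h) })
    }
    where
    module |G| = Inverse |G|
    module |H| = Inverse |H|

  ×-power : ∀ n g h → proj₁ (Powers._·_ (G ×ᴳ H) n (g , h)) ≡ Powers._·_ G n g ×
                      proj₂ (Powers._·_ (G ×ᴳ H) n (g , h)) ≡ Powers._·_ H n h
  ×-power zero    g h = ≡.refl , ≡.refl
  ×-power (suc n) g h = cong (g G.∙_) (proj₁ (×-power n g h)) , cong (h H.∙_) (proj₂ (×-power n g h))

  ∈-proj₁ : ∀ {u w} → u ∈ ⟨ G ×ᴳ H ⟩ w → proj₁ u ∈ ⟨ G ⟩ (proj₁ w)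
  ∈-proj₁ = map-⟨⟩ {G = G ×ᴳ H} {H = G} proj₁ proj₁ G.refl (λ _ _ → G.refl) (λ _ → G.refl)

  ∈-proj₂ : ∀ {u w} → u ∈ ⟨ G ×ᴳ H ⟩ w → proj₂ u ∈ ⟨ H ⟩ (proj₂ w)
  ∈-proj₂ = map-⟨⟩ {G = G ×ᴳ H} {H = H} proj₂ proj₂ H.refl (λ _ _ → H.refl) (λ _ → H.refl)

  -- Coprime orders let the Chinese remainder theorem supply one exponent that works in both
  -- factors.
  ∈-× : ∀ {m n} → HasOrder G m → HasOrder H n → Coprime m n →
        ∀ {g h w x} → g ∈ ⟨ G ⟩ w → h ∈ ⟨ H ⟩ x → (g , h) ∈ ⟨ G ×ᴳ H ⟩ (w , x)
  ∈-× {m} {n} |G| |H| m⊥n {w = w} {x} g∈ h∈ =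
    let s , g≈ = 𝓖.∈⟨⟩⇒power g∈
        t , h≈ = 𝓗.∈⟨⟩⇒power h∈
        z , z≡s , z≡t = crt₂ {{𝓖.n≢0}} {{𝓗.n≢0}} m⊥n s t
    in resp (G.trans (G.reflexive (proj₁ (×-power z w x))) (G.trans (Powers.mod-· G (𝓖.lagrange w) z≡s) (G.sym g≈)) ,
             H.trans (H.reflexive (proj₂ (×-power z w x))) (H.trans (Powers.mod-· H (𝓗.lagrange x) z≡t) (H.sym h≈)))
            (Powers.power∈ (G ×ᴳ H) z (w , x))
    where
    module 𝓖 = Finite G m |G|
    module 𝓗 = Finite H n |H|

-- The generator `ζ` of the cyclic factor reaches every first component, so being joined depends on
-- the second components alone.
cyclic-×-cliques : ∀ {Z : Group c₁ ℓ₁} {Q : Group c₂ ℓ₂} {n o r} → IsCyclic Z → HasOrder Z n →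
                   HasOrder Q o → Coprime n o → CliquePartition Q r → CliquePartition (Z ×ᴳ Q) r
cyclic-×-cliques {Z = Z} {Q} {n} {o} (ζ , ζ-generates) |Z| |Q| n⊥o S = record
  { _≟_            = λ (a , q) (b , r) → Finite._≟_ Z n |Z| a b ×-dec S._≟_ q r
  ; 2≤r            = S.2≤r
  ; class          = S.class ∘ proj₂
  ; class-cong     = S.class-cong ∘ proj₂
  ; rep            = λ i → Group.ε Z , S.rep i
  ; twin           = λ i → Group.ε Z , S.twin i
  ; class-rep      = S.class-rep
  ; class-twin     = S.class-twin
  ; rep≉twin       = λ i → S.rep≉twin i ∘ proj₂
  ; joined-class   = λ (w , u∈ , v∈) → S.joined-class (proj₂ w , ∈-proj₂ {G = Z} {Q} u∈ , ∈-proj₂ {G = Z} {Q} v∈)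
  ; clique         = λ ua va → join (S.clique ua va)
  ; trivial-joined = λ uₙ v → join (S.trivial-joined uₙ (proj₂ v))
  }
  where
  module S = CliquePartition S
  join : ∀ {u v} → Joined Q (proj₂ u) (proj₂ v) → Joined (Z ×ᴳ Q) u v
  join {u} {v} (w , u∈ , v∈) = (ζ , w) ,
    ∈-× {G = Z} {Q} |Z| |Q| n⊥o (ζ-generates (proj₁ u)) u∈ ,
    ∈-× {G = Z} {Q} |Z| |Q| n⊥o (ζ-generates (proj₁ v)) v∈

cliques⇒coordinate : ∀ {G : Group c ℓ} {r} → CliquePartition G r → Coordinate G r
cliques⇒coordinate S = record
  { _≟_            = _≟_
  ; 2≤r            = 2≤r
  ; class          = class
  ; class-cong     = class-cong
  ; rep            = rep
  ; class-rep      = class-rep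
  ; joined-class   = joined-class
  ; joined-rep     = λ ui → clique ui (class-rep _)
  ; trivial-joined = trivial-joined
  }
  where open CliquePartition S

module _ {G : Group c ℓ} {r} (S : Coordinate G r) where
  open Group G
  open Coordinate S

  -- The identity is joined to every representative, so a class of its own would have to equal two
  -- different classes.
  class-ε : class ε ≡ nothing
  class-ε = ¬just⇒nothing λ (a , εa) → let b , b≢a = different 2≤r a in
    b≢a (≡.sym (joined-class (rep b , one , gen refl) εa (class-rep b)))

  repOrε : Maybe (Fin r) → Carrier
  repOrε = maybe′ rep ε

  class-repOrε : ∀ x → class (repOrε x) ≡ x
  class-repOrε (just i) = class-rep i
  class-repOrε nothing  = class-ε

  joined-repOrε : ∀ {u x} → Compatible (class u) x → Joined G u (repOrε x)
  joined-repOrε         (inj₁ uₙ)              = trivial-joined uₙ _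
  joined-repOrε {u}     (inj₂ (inj₁ ≡.refl))   = u , gen refl , one
  joined-repOrε {x = x} (inj₂ (inj₂ u≡x)) with x
  ... | just i  = joined-rep u≡x
  ... | nothing = trivial-joined u≡x _

module _ {m} (P : Fin m → Group c ℓ) (Q : Group c₂ ℓ₂)
         {e : Fin m → ℕ} {o : ℕ} (|P| : ∀ i → HasOrder (P i) (e i)) (|Q| : HasOrder Q o)
         (e⊥e : ∀ {i j} → i ≢ j → Coprime (e i) (e j)) (e⊥o : ∀ i → Coprime (e i) o) where
  private
    G = Π P ×ᴳ Q
    module Q = Group Q
    module P i = Group (P i)

  -- Index `fzero` stands for `Q` and the successors for the factors of `Π P`; `classCount` follows
  -- the same convention.
  order : Fin (suc m) → ℕ
  order fzero    = o
  order (fsuc i) = e i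

  order≢0 : ∀ i → NonZero (order i)
  order≢0 fzero    = Finite.n≢0 Q o |Q|
  order≢0 (fsuc i) = Finite.n≢0 (P i) (e i) (|P| i)

  order⊥order : ∀ {i j} → i ≢ j → Coprime (order i) (order j)
  order⊥order {fzero}  {fzero}  i≢j = contradiction ≡.refl i≢j
  order⊥order {fzero}  {fsuc j} _   = Coprimality.sym (e⊥o j)
  order⊥order {fsuc i} {fzero}  _   = e⊥o i
  order⊥order {fsuc i} {fsuc j} i≢j = e⊥e (i≢j ∘ cong fsuc)

  Π-power : ∀ n g i → Powers._·_ (Π P) n g i ≡ Powers._·_ (P i) n (g i)
  Π-power zero    g i = ≡.refl
  Π-power (suc n) g i = cong (P._∙_ i (g i)) (Π-power n g i)

  ∈-Π× : ∀ {g q w x} → (∀ i → g i ∈ ⟨ P i ⟩ (w i)) → q ∈ ⟨ Q ⟩ x → (g , q) ∈ ⟨ G ⟩ (w , x)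
  ∈-Π× {g} {q} {w} {x} g∈ q∈ = resp
    ((λ i → P.trans i (P.reflexive i (≡.trans (cong (λ f → f i) (proj₁ (×-power {G = Π P} {H = Q} solution w x))) (Π-power solution w i)))
              (P.trans i (Powers.mod-· (P i) (Finite.lagrange (P i) (e i) (|P| i) (w i)) (solves (fsuc i)))
                         (P.sym i (proj₂ (g-power i))))) ,
     Q.trans (Q.reflexive (proj₂ (×-power {G = Π P} {H = Q} solution w x)))
       (Q.trans (Powers.mod-· Q (Finite.lagrange Q o |Q| x) (solves fzero)) (Q.sym (proj₂ q-power))))
    (Powers.power∈ G solution (w , x))
    where
    g-power : ∀ i → ∃[ s ] P._≈_ i (g i) (Powers._·_ (P i) s (w i))
    g-power i = Finite.∈⟨⟩⇒power (P i) (e i) (|P| i) (g∈ i)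
    q-power : ∃[ s ] q Q.≈ Powers._·_ Q s x
    q-power = Finite.∈⟨⟩⇒power Q o |Q| q∈
    exponent : Fin (suc m) → ℕ
    exponent fzero    = proj₁ q-power
    exponent (fsuc i) = proj₁ (g-power i)
    open Modulus (crt order order≢0 order⊥order exponent) using (solution; solves)

  joined-Π× : ∀ {g h q s} → (∀ i → Joined (P i) (g i) (h i)) → Joined Q q s → Joined G (g , q) (h , s)
  joined-Π× g—h (x , q∈ , s∈) = ((λ i → proj₁ (g—h i)) , x) ,
    ∈-Π× (λ i → proj₁ (proj₂ (g—h i))) q∈ , ∈-Π× (λ i → proj₂ (proj₂ (g—h i))) s∈

  ∈-Π : ∀ i {g w} → g ∈ ⟨ Π P ⟩ w → g i ∈ ⟨ P i ⟩ (w i)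
  ∈-Π i = map-⟨⟩ {G = Π P} {H = P i} (λ g → g i) (λ g≈h → g≈h i) (P.refl i) (λ _ _ → P.refl i) (λ _ → P.refl i)

  module _ {r : Fin m → ℕ} {s} (coordinate : ∀ i → Coordinate (P i) (r i)) (D : Coordinate Q s) where
    private
      module 𝓒 i = Coordinate (coordinate i)
      module 𝓓 = Coordinate D

    classCount : Fin (suc m) → ℕ
    classCount fzero    = s
    classCount (fsuc i) = r i

    coordinates : System G classCount
    coordinates = record
      { _≟_            = λ (g , q) (h , t) → all? (λ i → 𝓒._≟_ i (g i) (h i)) ×-dec 𝓓._≟_ q t
      ; 2≤r            = λ { fzero → 𝓓.2≤r ; (fsuc i) → 𝓒.2≤r i }
      ; class          = class
      ; class-cong     = λ { fzero (_ , q≈) → 𝓓.class-cong q≈ ; (fsuc i) (g≈ , _) → 𝓒.class-cong i (g≈ i) }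
      ; rep            = λ f → (λ i → repOrε (coordinate i) (f (fsuc i))) , repOrε D (f fzero)
      ; class-rep      = λ { f fzero → class-repOrε D (f fzero)
                           ; f (fsuc i) → class-repOrε (coordinate i) (f (fsuc i)) }
      ; joined-class   = joined-class
      ; joined-rep     = λ compatible → joined-Π×
          (λ i → joined-repOrε (coordinate i) (compatible (fsuc i))) (joined-repOrε D (compatible fzero))
      ; trivial-joined = λ trivial (h , t) → joined-Π×
          (λ i → 𝓒.trivial-joined i (trivial (fsuc i)) (h i)) (𝓓.trivial-joined (trivial fzero) t)
      }
      where
      class : ∀ j → Group.Carrier G → Maybe (Fin (classCount j))
      class fzero    (g , q) = 𝓓.class q
      class (fsuc i) (g , q) = 𝓒.class i (g i)
      joined-class : ∀ j {u v a b} → Joined G u v → class j u ≡ just a → class j v ≡ just b → a ≡ b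
      joined-class fzero    (w , u∈ , v∈) =
        𝓓.joined-class (proj₂ w , ∈-proj₂ {G = Π P} {H = Q} u∈ , ∈-proj₂ {G = Π P} {H = Q} v∈)
      joined-class (fsuc i) (w , u∈ , v∈) =
        𝓒.joined-class i (proj₁ w i , ∈-Π i (∈-proj₁ {G = Π P} {H = Q} u∈) , ∈-Π i (∈-proj₁ {G = Π P} {H = Q} v∈))

-- The domination number of the products

Π×-number : ∀ {m} {P : Fin (suc m) → Group c ℓ} {p : Fin (suc m) → ℕ} {N} →
  IsOddNilpotentWithNonCyclicSylows P p N →
  {r : Fin (suc m) → ℕ} → (∀ i → HasCardinality (subgroupsOfOrder (P i) (p i)) (r i)) →
  (∀ i j → i ≤ᶠ j → r i ≤ r j) →
  ∀ {Q : Group c₂ ℓ₂} {o s} → HasOrder Q o → (∀ i → Coprime (p i) o) → Coordinate Q s →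
  StrongDominationNumber (properEnhancedPowerGraph (Π P ×ᴳ Q)) (suc (r fzero ⊓ s))
Π×-number {P = P} {p} {N} isNilpotent {r} |𝓗| r-mono {Q} {o} {s} |Q| p⊥o D =
  -- Of the first Sylow subgroup and `Q`, the one with fewer classes supplies the representatives
  -- and the other supports the extra vertex. Monotonicity of `r` makes `r fzero` least among the
  -- Sylow factors.
  [ (λ r≤s → subst (StrongDominationNumber _ ∘ suc) (≡.sym (ℕₚ.m≤n⇒m⊓n≡m r≤s))
      (minimal-coordinate-number S {fsuc fzero} {fzero} (λ ())
        λ { fzero → r≤s ; (fsuc i) → r-mono fzero i z≤n }))
  , (λ s≤r → subst (StrongDominationNumber _ ∘ suc) (≡.sym (ℕₚ.m≥n⇒m⊓n≡n s≤r))
      (minimal-coordinate-number S {fzero} {fsuc fzero} (λ ())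
        λ { fzero → ℕₚ.≤-refl ; (fsuc i) → ℕₚ.≤-trans s≤r (r-mono fzero i z≤n) }))
  ]′ (ℕₚ.≤-total (r fzero) s)
  where
  open IsOddNilpotentWithNonCyclicSylows isNilpotent
  p-prime-divisor : ∀ i → Prime (p i) × p i ∣ N
  p-prime-divisor i = Equivalence.from (p-primes (p i)) (i , ≡.refl)
  p-odd : ∀ i → ¬ (2 ∣ p i)
  p-odd i 2∣p = odd (Div.∣-trans 2∣p (proj₂ (p-prime-divisor i)))
  p⊥p : ∀ {i j} → i ≢ j → Coprime (p i) (p j)
  p⊥p {i} {j} i≢j = Coprimality.sym (prime∤⇒coprime (proj₁ (p-prime-divisor i)) λ pᵢ∣pⱼ →
    [ (λ pᵢ≡1 → contradiction pᵢ≡1 (ℕₚ.>⇒≢ (nonTrivial⇒n>1 (p i) {{prime⇒nonTrivial (proj₁ (p-prime-divisor i))}})))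
    , (λ pᵢ≡pⱼ → i≢j (p-injective pᵢ≡pⱼ)) ]′ (prime⇒irreducible (proj₁ (p-prime-divisor j)) pᵢ∣pⱼ))
  exponent : Fin _ → ℕ
  exponent i = proj₁ (sylow i)
  |P| : ∀ i → HasOrder (P i) (p i ^ exponent i)
  |P| i = proj₁ (proj₂ (sylow i))
  S : System (Π P ×ᴳ Q) _
  S = coordinates P Q |P| |Q|
    (λ {i} {j} i≢j → coprime-^ (exponent i) (Coprimality.sym (coprime-^ (exponent j) (Coprimality.sym (p⊥p i≢j)))))
    (λ i → coprime-^ (exponent i) (p⊥o i))
    (λ i → primeSubgroupCoordinate (P i) (p i) (exponent i) (proj₁ (p-prime-divisor i)) (|P| i) (p-odd i)
             (nilpotent-factor P nilpotent i) (nonCyclic i) (|𝓗| i)) D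

theorem2p4 : ∀ {c₁ ℓ₁ c₂ ℓ₂ c₃ ℓ₃}
    (k : ℕ) → 3 ≤ k →
    (Q : Group c₁ ℓ₁) → IsGeneralizedQuaternion Q k →
    (n : ℕ) → ¬ (2 ∣ n) →
    (Z : Group c₂ ℓ₂) → IsCyclic Z → HasOrder Z n →
    (StrongDominationNumber (properEnhancedPowerGraph Q) (2 ^ (k ∸ 1) + 2) ×
    StrongDominationNumber (properEnhancedPowerGraph (Z ×ᴳ Q)) (2 ^ (k ∸ 1) + 2)) ×
    (∀ m (P : Fin (suc m) → Group c₃ ℓ₃) (p : Fin (suc m) → ℕ) (N : ℕ) →
    IsOddNilpotentWithNonCyclicSylows P p N →
    (r : Fin (suc m) → ℕ) →
    (∀ i → HasCardinality (subgroupsOfOrder (P i) (p i)) (r i)) →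
    (∀ i j → i ≤ᶠ j → r i ≤ r j) →
    StrongDominationNumber (properEnhancedPowerGraph (Π P ×ᴳ Q))
    ((r fzero ⊓ (2 ^ (k ∸ 2) + 1)) + 1) ×
    (gcd N n ≡ 1 →
    StrongDominationNumber (properEnhancedPowerGraph (Π P ×ᴳ (Z ×ᴳ Q)))
    ((r fzero ⊓ (2 ^ (k ∸ 2) + 1)) + 1)))
-- Writing `k` as `3 + d` makes `k ∸ 1` and `k ∸ 2` compute to `2 + d` and `1 + d`.
theorem2p4 k 3≤k Q Q-quaternion n 2∤n Z Z-cyclic |Z| with d , ≡.refl ← ℕₚ.m≤n⇒∃[o]m+o≡n 3≤k =
  (subst (StrongDominationNumber _) (double K) (clique-number Q-cliques) ,
   subst (StrongDominationNumber _) (double K) (clique-number ZQ-cliques)) ,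
  λ m P p N isNilpotent r |𝓗| r-mono →
    let open IsOddNilpotentWithNonCyclicSylows isNilpotent using (odd; p-primes)
        p∣N = λ i → proj₂ (Equivalence.from (p-primes (p i)) (i , ≡.refl))
        p⊥2ᵏ : ∀ i → Coprime (p i) (2 ^ (3 + d))
        p⊥2ᵏ i = odd⊥2ᵏ (λ 2∣p → odd (Div.∣-trans 2∣p (p∣N i)))
    in subst (StrongDominationNumber _) (shift (r fzero))
         (Π×-number isNilpotent |𝓗| r-mono |Q| p⊥2ᵏ (cliques⇒coordinate Q-cliques)) ,
       λ gcd≡1 → subst (StrongDominationNumber _) (shift (r fzero))
         (Π×-number isNilpotent |𝓗| r-mono (order-× {G = Z} {Q} |Z| |Q|)
           -- As a divisor of `N`, `p i` is coprime to `n`; as an odd number it is coprime to 2^k,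
           -- and so to the order of `Z ×ᴳ Q`.
           (λ i → Coprimality.sym (coprime-* {n} (λ (x∣n , x∣p) → gcd≡1⇒coprime gcd≡1 (Div.∣-trans x∣p (p∣N i) , x∣n))
                                             (Coprimality.sym (p⊥2ᵏ i))))
           (cliques⇒coordinate ZQ-cliques))
  where
  K = 2 ^ (1 + d)
  |Q| : HasOrder Q (2 ^ (3 + d))
  |Q| = IsGeneralizedQuaternion.order Q-quaternion
  odd⊥2ᵏ : ∀ {n} → ¬ (2 ∣ n) → Coprime n (2 ^ (3 + d))
  odd⊥2ᵏ 2∤n = Coprimality.sym (coprime-^ (3 + d) (Coprimality.sym (prime∤⇒coprime prime[2] 2∤n)))
  Q-cliques : CliquePartition Q (suc K)
  Q-cliques = quaternion-cliques d Q-quaternion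
  ZQ-cliques : CliquePartition (Z ×ᴳ Q) (suc K)
  ZQ-cliques = cyclic-×-cliques Z-cyclic |Z| |Q| (odd⊥2ᵏ 2∤n) Q-cliques
  double : ∀ K → suc K + suc K ≡ 2 * K + 2
  double = solve-∀
  shift : ∀ r → suc (r ⊓ suc K) ≡ (r ⊓ (K + 1)) + 1
  shift r = ≡.trans (cong (λ s → suc (r ⊓ s)) (ℕₚ.+-comm 1 K)) (ℕₚ.+-comm 1 _)
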